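{- Let $k,l$ be integers with either (i) $k\ge 4$ and $l\ge 3$, or (ii) $k=3$ and $l\ge 2074$. Then the graph $\overline{T_{n,l-1}}$ is not optimal for the $(k,l)$-problem: there is $N$ such that for every $n\ge N$ there exists an $n$-vertex graph $G$ with $\alpha(G)<l$ and $t_k(G)<t_k(\overline{T_{n,l-1}})$; that is, $f(n,k,l)<t_k(\overline{T_{n,l-1}})$.
   Context: For a graph $G$, $\alpha(G)$ is its independence number and $t_k(G)$ is the number of $k$-cliques in $G$. $f(n,k,l)$ is the minimum of $t_k(G)$ over $n$-vertex graphs $G$ with $\alpha(G)<l$ (the "$(k,l)$-problem"). $\overline{T_{n,l-1}}$ denotes the complement of the Turán graph, i.e. the disjoint union of $l-1$ cliques on $n$ vertices in total whose sizes are as equal as possible; it has $\alpha=l-1$. -}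

module Defs where

open import Data.Nat using (ℕ; zero; suc; _%_; _≡ᵇ_)
open import Data.Bool using (Bool; true; false; _∧_; _∨_; not)
open import Data.Fin using (Fin; toℕ; _≟_)
open import Data.Fin.Subset using (Subset; _∈_; ∣_∣; inside; outside)
open import Data.Vec using (Vec; []; _∷_; lookup)
open import Data.List using (List; []; _∷_; map; _++_; length; filter; foldr; allFin)
open import Relation.Nullary using (¬_; does)
open import Relation.Binary.PropositionalEquality using (_≡_)

record Graph (n : ℕ) : Set where
  field
    adj    : Fin n → Fin n → Bool
    sym    : ∀ i j → adj i j ≡ adj j i
    irrefl : ∀ i → adj i i ≡ false
open Graph public

IsIndependent : ∀ {n} → Graph n → Subset n → Set
IsIndependent G S = ∀ i j → i ∈ S → j ∈ S → ¬ (i ≡ j) → adj G i j ≡ false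

IndepNumberLessThan : ∀ {n} → Graph n → ℕ → Set
IndepNumberLessThan G l = ∀ S → IsIndependent G S → ∣ S ∣ Data.Nat.< l

allSubsets : (n : ℕ) → List (Subset n)
allSubsets zero = [] ∷ []
allSubsets (suc n) = map (inside ∷_) (allSubsets n) ++ map (outside ∷_) (allSubsets n)

memᵇ : ∀ {n} → Fin n → Subset n → Bool
memᵇ i S with lookup S i
... | inside = true
... | outside = false

allᵇ : {A : Set} → (A → Bool) → List A → Bool
allᵇ p = foldr (λ x b → p x ∧ b) true

isCliqueᵇ : ∀ {n} → Graph n → Subset n → Bool
isCliqueᵇ {n} G S =
  allᵇ (λ i → allᵇ (λ j → not (memᵇ i S ∧ memᵇ j S ∧ not (does (i ≟ j))) ∨ adj G i j) (allFin n)) (allFin n)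

cliqueCount : ∀ {n} → ℕ → Graph n → ℕ
cliqueCount {n} k G =
  length (filter (λ S → Data.Bool._≟_ (isCliqueᵇ G S ∧ (∣ S ∣ ≡ᵇ k)) true) (allSubsets n))

-- Part index of vertex i in the balanced partition of Fin n into r classes
-- (vertex i goes to class i mod r); r = 0 is a degenerate case, never used.
part : ∀ {n} → ℕ → Fin n → ℕ
part zero i = 0
part (suc r) i = toℕ i % suc r

-- Complement of the Turán graph T_{n,r}: disjoint union of r cliques
-- with sizes as equal as possible (class sizes are ⌊n/r⌋ or ⌈n/r⌉).
turanComplement : (n r : ℕ) → Graph n
turanComplement n r = record
  { adj = λ i j → (part r i ≡ᵇ part r j) ∧ not (does (i ≟ j))
  ; sym = symP
  ; irrefl = irr
  }
  where
  open import Relation.Binary.PropositionalEquality using (refl; cong₂)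
  open import Data.Nat.Properties using (≡ᵇ⇒≡; ≡⇒≡ᵇ)
  irr : ∀ i → ((part r i ≡ᵇ part r i) ∧ not (does (i ≟ i))) ≡ false
  irr i with i ≟ i
  ... | Relation.Nullary.yes _ = Data.Bool.Properties.∧-zeroʳ _
    where import Data.Bool.Properties
  ... | Relation.Nullary.no q = Data.Empty.⊥-elim (q refl)
    where import Data.Empty
  symℕ : ∀ a b → (a ≡ᵇ b) ≡ (b ≡ᵇ a)
  symℕ zero zero = refl
  symℕ zero (suc b) = refl
  symℕ (suc a) zero = refl
  symℕ (suc a) (suc b) = symℕ a b
  symF : ∀ (i j : Fin n) → does (i ≟ j) ≡ does (j ≟ i)
  symF i j with i ≟ j | j ≟ i
  ... | Relation.Nullary.yes _ | Relation.Nullary.yes _ = refl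
  ... | Relation.Nullary.no _ | Relation.Nullary.no _ = refl
  ... | Relation.Nullary.yes refl | Relation.Nullary.no q = Data.Empty.⊥-elim (q refl)
    where import Data.Empty
  ... | Relation.Nullary.no q | Relation.Nullary.yes refl = Data.Empty.⊥-elim (q refl)
    where import Data.Empty
  symP : ∀ i j → ((part r i ≡ᵇ part r j) ∧ not (does (i ≟ j))) ≡ ((part r j ≡ᵇ part r i) ∧ not (does (j ≟ i)))
  symP i j = cong₂ (λ a b → a ∧ not b) (symℕ (part r i) (part r j)) (symF i j)

{-# OPTIONS --safe #-}

-- Take a reflexive relation on m labels, give the vertices of Fin n the labels 0, 1, …, m−1 cyclically,
-- and join distinct vertices with related labels.  The independence number is that of the relation, and
-- k! times the number of k-cliques is asymptotically (n/m)^k h, where h counts the k-tuples of pairwise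
-- related labels.  Since k! t_k of the complement of T_{n,r} is asymptotically r (n/r)^k, it suffices to
-- find a relation with independence number at most r and r^(k−1) h < m^k.  Blowing such a relation up by
-- r and adding a clique of m labels turns r into r + 1, so only the smallest r is needed.
--   For k ≥ 4 and r = 2 the 5-cycle works, as h = 5 (2^k − 1).
--   For k = 3 and r = 2073 a random graph on 162000 vertices with edge probability 1/194 works, as
-- h = m + 6 e + 6 t in terms of its numbers of edges and triangles.
module Submission where

open import Defs hiding (sym)
open import Algebra.Properties.Semiring.Sum using ()
open import Data.Bool using (Bool; true; false; _∧_; _∨_; not; T; if_then_else_)
open import Data.Bool.Properties using (∧-zeroʳ; ∧-identityʳ; ∧-assoc; ∧-comm; ∧-idem; ⇔→≡)
open import Data.Empty using (⊥-elim)
open import Data.Fin using (Fin; zero; suc; toℕ; splitAt; _↑ˡ_; _↑ʳ_; _≟_)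
open import Data.Fin.Properties using (toℕ-fromℕ<; toℕ-injective; toℕ<n; splitAt-↑ˡ; splitAt-↑ʳ; all?)
  renaming (suc-injective to suc-injectiveᶠ)
open import Data.Fin.Subset using (Subset; ∣_∣; _∈_)
open import Data.List using (List; []; _∷_; map; length; filter; allFin)
open import Data.List.Membership.Propositional using () renaming (_∈_ to _∈ˡ_)
open import Data.List.Membership.Propositional.Properties using (∈-allFin)
open import Data.List.Properties using (length-++; filter-++; length-map)
open import Data.List.Relation.Unary.All as All using (All; []; _∷_)
open import Data.List.Relation.Unary.AllPairs as AllPairs using (AllPairs; []; _∷_)
open import Data.List.Relation.Unary.AllPairs.Properties using (map⁺)
open import Data.List.Relation.Unary.Any using (here; there)
open import Data.Nat using (ℕ; zero; suc; _+_; _*_; _∸_; _^_; _/_; _%_; _≤_; _<_; _≡ᵇ_; _!; z≤n; s≤s; s≤s⁻¹; NonZero; >-nonZero)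
open import Data.Nat.Combinatorics using (_C_; nCk+nC[k+1]≡[n+1]C[k+1])
open import Data.Nat.DivMod using (_mod_; m%n<n; [m+n]%n≡m%n; m<n⇒m%n≡m; m/n*n≤m; m≡m%n+[m/n]*n)
open import Data.Nat.Properties hiding (_≟_)
open import Data.Nat.Tactic.RingSolver using (solve-∀)
open import Data.Product using (Σ; ∃; _×_; _,_; proj₁; proj₂)
open import Data.Sum using (_⊎_; inj₁; inj₂)
open import Data.Unit using (⊤; tt)
open import Data.Vec using (Vec; []; _∷_; here; there; lookup)
open import Function using (_∘_; id; mk⇔)
open import Relation.Binary.PropositionalEquality using (_≡_; _≢_; _≗_; refl; sym; trans; cong; cong₂; subst; module ≡-Reasoning)
open import Relation.Nullary using (does; yes; no)
open import Relation.Nullary.Decidable using (from-yes; dec-false; does-⇔; _→-dec_; ¬?)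
open Algebra.Properties.Semiring.Sum +-*-semiring

-- Tuples with repetition scale by a power of the blow-up factor and, when nonempty, add over
-- disjoint unions, so no binomial coefficients enter. The lower-order errors, from repeated
-- vertices and from n not being a multiple of m or r, are absorbed by the strictness of r^(k-1) h <
-- m^k. The 5-cycle fails for k = 3, where 4 · 35 = 140 exceeds 125: tuples with repeated labels
-- weigh too much. The random graph has to be sparse enough to keep m + 6 e + 6 t below m³ / r² and
-- dense enough to have no independent set of r + 1 vertices. With the chosen parameters the mean of
-- 6 e + 6 t is already about 99.9 % of the allowance m³ / r² - m, so only about a thousandth is
-- left for the risk of a large independent set. Both demands are therefore put into one weighted
-- sum whose mean lies below the threshold. Means stay in ℕ by giving an edge the weight 1 and a
-- non-edge the weight 193.

Rel₂ : ℕ → Set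
Rel₂ n = Fin n → Fin n → Bool

Symmetric₂ : ∀ {n} → Rel₂ n → Set
Symmetric₂ A = ∀ i j → A i j ≡ A j i

⟦_⟧ : Bool → ℕ
⟦ true ⟧  = 1
⟦ false ⟧ = 0

⟦⟧≤suc : ∀ b x → ⟦ b ⟧ ≤ suc x
⟦⟧≤suc true  x = s≤s z≤n
⟦⟧≤suc false x = z≤n

⟦⟧*≤ : ∀ b x → ⟦ b ⟧ * x ≤ x
⟦⟧*≤ true  x = ≤-reflexive (*-identityˡ x)
⟦⟧*≤ false x = z≤n

sum-mono : ∀ {n} {f g : Fin n → ℕ} → (∀ i → f i ≤ g i) → sum f ≤ sum g
sum-mono {zero}  h = z≤n
sum-mono {suc n} h = +-mono-≤ (h zero) (sum-mono (h ∘ suc))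

infixl 7 _∩_
_∩_ : ∀ {n} → (Fin n → Bool) → (Fin n → Bool) → Fin n → Bool
(P ∩ Q) i = P i ∧ Q i

full : ∀ {n} → Fin n → Bool
full _ = true

tail₂ : ∀ {n} → Rel₂ (suc n) → Rel₂ n
tail₂ A i j = A (suc i) (suc j)

-- Unordered and ordered cliques

cliques : ∀ {n} → Rel₂ n → (Fin n → Bool) → ℕ → ℕ
cliques A P zero = 1
cliques {zero} A P (suc k) = 0
cliques {suc n} A P (suc k) =
  ⟦ P zero ⟧ * cliques (tail₂ A) ((P ∩ A zero) ∘ suc) k + cliques (tail₂ A) (P ∘ suc) (suc k)

-- `P` is the set of vertices still allowed. For a loopless `A` these are the ordered cliques; for a
-- reflexive `A` entries may repeat, and the same formula gives the quantity h.
cliqueTuples : ∀ {n} → Rel₂ n → (Fin n → Bool) → ℕ → ℕ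
cliqueTuples A P zero    = 1
cliqueTuples A P (suc k) = sum (λ v → ⟦ P v ⟧ * cliqueTuples A (P ∩ A v) k)

cliques-cong : ∀ {n} (A : Rel₂ n) {P Q : Fin n → Bool} → P ≗ Q → ∀ k → cliques A P k ≡ cliques A Q k
cliques-cong A P≗Q zero = refl
cliques-cong {zero} A P≗Q (suc k) = refl
cliques-cong {suc n} A P≗Q (suc k) = cong₂ _+_
  (cong₂ _*_ (cong ⟦_⟧ (P≗Q zero))
    (cliques-cong (tail₂ A) (λ i → cong (_∧ A zero (suc i)) (P≗Q (suc i))) k))
  (cliques-cong (tail₂ A) (P≗Q ∘ suc) (suc k))

-- Double counting of the pairs (vertex, (k+1)-clique containing it).
cliques-by-vertex : ∀ {n} (A : Rel₂ n) → Symmetric₂ A → (∀ i → A i i ≡ false) → ∀ P k →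
  suc k * cliques A P (suc k) ≡ sum (λ v → ⟦ P v ⟧ * cliques A (P ∩ A v) k)
cliques-by-vertex {zero} A A-sym A-irr P k = *-zeroʳ (suc k)
cliques-by-vertex {suc n} A A-sym A-irr P zero = begin
  1 * (⟦ P zero ⟧ * 1 + cliques A′ (P ∘ suc) 1)
    ≡⟨ *-identityˡ _ ⟩
  ⟦ P zero ⟧ * 1 + cliques A′ (P ∘ suc) 1
    ≡⟨ cong (⟦ P zero ⟧ * 1 +_) (trans (sym (*-identityˡ _)) (cliques-by-vertex A′ (λ i j → A-sym _ _) (λ i → A-irr _) (P ∘ suc) 0)) ⟩
  ⟦ P zero ⟧ * 1 + sum (λ v → ⟦ P (suc v) ⟧ * 1) ∎
  where
  open ≡-Reasoning
  A′ = tail₂ A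
cliques-by-vertex {suc n} A A-sym A-irr P (suc k) = begin
  suc (suc k) * (p * c₁ + c₂)
    -- Of the k + 2 copies of `p * c₁`, one is the contribution of the vertex `zero`; the other k +
    -- 1 belong to the remaining vertices of those cliques and are opened by induction.
    ≡⟨ rearrange k p c₁ c₂ ⟩
  p * c₁ + (p * (suc k * c₁) + suc (suc k) * c₂)
    ≡⟨ cong₂ (λ x y → p * c₁ + (p * x + y))
         (cliques-by-vertex A′ sym′ irr′ (P′ ∩ N₀) k) (cliques-by-vertex A′ sym′ irr′ P′ (suc k)) ⟩
  p * c₁ + (p * sum f + sum g)
    ≡⟨ cong (λ x → p * c₁ + (x + sum g)) (*-distribˡ-sum p f) ⟩
  p * c₁ + (sum (λ v → p * f v) + sum g)
    ≡⟨ cong₂ _+_ (cong (p *_) first) (trans (sym (∑-distrib-+ (λ v → p * f v) g)) (sum-cong-≗ rest)) ⟩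
  p * cliques A (P ∩ A zero) (suc k) + sum (λ v → ⟦ P (suc v) ⟧ * cliques A (P ∩ A (suc v)) (suc k)) ∎
  where
  open ≡-Reasoning
  A′ = tail₂ A
  P′ = P ∘ suc
  N₀ = A zero ∘ suc
  p  = ⟦ P zero ⟧
  c₁ = cliques A′ (P′ ∩ N₀) (suc k)
  c₂ = cliques A′ P′ (suc (suc k))
  f g : Fin n → ℕ
  f v = ⟦ P′ v ∧ N₀ v ⟧ * cliques A′ ((P′ ∩ N₀) ∩ A′ v) k
  g v = ⟦ P′ v ⟧ * cliques A′ (P′ ∩ A′ v) (suc k)
  sym′ : Symmetric₂ A′
  sym′ i j = A-sym (suc i) (suc j)
  irr′ : ∀ i → A′ i i ≡ false
  irr′ i = A-irr (suc i)
  rearrange : ∀ k p c₁ c₂ → suc (suc k) * (p * c₁ + c₂) ≡ p * c₁ + (p * (suc k * c₁) + suc (suc k) * c₂)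
  rearrange = solve-∀
  first : c₁ ≡ cliques A (P ∩ A zero) (suc k)
  first rewrite A-irr zero | ∧-zeroʳ (P zero) = refl
  pull : ∀ (a b c : Bool) x y z → x ≡ y → ⟦ a ⟧ * (⟦ b ∧ c ⟧ * x) + ⟦ b ⟧ * z ≡ ⟦ b ⟧ * (⟦ a ∧ c ⟧ * y + z)
  pull false false c x y z refl = refl
  pull false true  c x y z refl = refl
  pull true  false c x y z refl = refl
  pull true  true  c x y z refl = solve-b ⟦ c ⟧ x z
    where
    solve-b : ∀ c x z → 1 * (c * x) + 1 * z ≡ 1 * (c * x + z)
    solve-b = solve-∀
  swap : ∀ a b c → (a ∧ b) ∧ c ≡ (a ∧ c) ∧ b
  swap a b c = trans (∧-assoc a b c) (trans (cong (a ∧_) (∧-comm b c)) (sym (∧-assoc a c b)))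
  rest : ∀ v → p * f v + g v ≡ ⟦ P (suc v) ⟧ * cliques A (P ∩ A (suc v)) (suc k)
  rest v rewrite A-sym (suc v) zero =
    pull (P zero) (P′ v) (N₀ v) _ _ _ (cliques-cong A′ (λ i → swap (P′ i) (N₀ i) (A′ v i)) k)

!*cliques≡cliqueTuples : ∀ {n} (A : Rel₂ n) → Symmetric₂ A → (∀ i → A i i ≡ false) → ∀ P k →
  k ! * cliques A P k ≡ cliqueTuples A P k
!*cliques≡cliqueTuples A A-sym A-irr P zero = refl
!*cliques≡cliqueTuples A A-sym A-irr P (suc k) = begin
  (suc k * k !) * cliques A P (suc k)
    ≡⟨ arrange (suc k) (k !) _ ⟩
  k ! * (suc k * cliques A P (suc k))
    ≡⟨ cong (k ! *_) (cliques-by-vertex A A-sym A-irr P k) ⟩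
  k ! * sum (λ v → ⟦ P v ⟧ * cliques A (P ∩ A v) k)
    ≡⟨ *-distribˡ-sum (k !) (λ v → ⟦ P v ⟧ * cliques A (P ∩ A v) k) ⟩
  sum (λ v → k ! * (⟦ P v ⟧ * cliques A (P ∩ A v) k))
    ≡⟨ sum-cong-≗ (λ v → trans (arrange′ (k !) ⟦ P v ⟧ _)
         (cong (⟦ P v ⟧ *_) (!*cliques≡cliqueTuples A A-sym A-irr (P ∩ A v) k))) ⟩
  sum (λ v → ⟦ P v ⟧ * cliqueTuples A (P ∩ A v) k) ∎
  where
  open ≡-Reasoning
  arrange : ∀ a b c → (a * b) * c ≡ b * (a * c)
  arrange = solve-∀
  arrange′ : ∀ a b c → a * (b * c) ≡ b * (a * c)
  arrange′ = solve-∀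

-- From cliqueCount to cliques

countᵇ : {X : Set} → (X → Bool) → List X → ℕ
countᵇ f xs = length (filter (λ x → f x Data.Bool.≟ true) xs)

countᵇ-cong : {X : Set} {f g : X → Bool} → f ≗ g → ∀ xs → countᵇ f xs ≡ countᵇ g xs
countᵇ-cong f≗g [] = refl
countᵇ-cong {f = f} {g} f≗g (x ∷ xs) with f x | g x | f≗g x
... | true  | true  | refl = cong suc (countᵇ-cong f≗g xs)
... | false | false | refl = countᵇ-cong f≗g xs

countᵇ-none : {X : Set} (xs : List X) → countᵇ (λ _ → false) xs ≡ 0
countᵇ-none [] = refl
countᵇ-none (x ∷ xs) = countᵇ-none xs

countᵇ-map : {X Y : Set} (f : Y → Bool) (h : X → Y) → ∀ xs → countᵇ f (map h xs) ≡ countᵇ (f ∘ h) xs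
countᵇ-map f h [] = refl
countᵇ-map f h (x ∷ xs) with f (h x)
... | true  = cong suc (countᵇ-map f h xs)
... | false = countᵇ-map f h xs

countᵇ-subsets : ∀ {n} (f : Subset (suc n) → Bool) →
  countᵇ f (allSubsets (suc n)) ≡
    countᵇ (f ∘ (true ∷_)) (allSubsets n) + countᵇ (f ∘ (false ∷_)) (allSubsets n)
countᵇ-subsets {n} f = trans
  (trans (cong length (filter-++ (λ x → f x Data.Bool.≟ true) (map (true ∷_) (allSubsets n)) _))
    (length-++ (filter (λ x → f x Data.Bool.≟ true) (map (true ∷_) (allSubsets n)))))
  (cong₂ _+_ (countᵇ-map f (true ∷_) (allSubsets n)) (countᵇ-map f (false ∷_) (allSubsets n)))

-- A clique test that recurses along the subset, in step with both `allSubsets` and `cliques`. It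
-- examines each pair in one order only, so `cliqueIn-sound` needs symmetry.
cliqueIn : ∀ {n} → Rel₂ n → (Fin n → Bool) → Subset n → Bool
cliqueIn A P []          = true
cliqueIn A P (true ∷ S)  = P zero ∧ cliqueIn (tail₂ A) ((P ∩ A zero) ∘ suc) S
cliqueIn A P (false ∷ S) = cliqueIn (tail₂ A) (P ∘ suc) S

countᵇ-cliqueIn : ∀ {n} (A : Rel₂ n) P k →
  countᵇ (λ S → cliqueIn A P S ∧ (∣ S ∣ ≡ᵇ k)) (allSubsets n) ≡ cliques A P k
countᵇ-cliqueIn {zero} A P zero = refl
countᵇ-cliqueIn {zero} A P (suc k) = refl
countᵇ-cliqueIn {suc n} A P zero = trans
  (countᵇ-subsets (λ S → cliqueIn A P S ∧ (∣ S ∣ ≡ᵇ 0)))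
  (cong₂ _+_
    (trans (countᵇ-cong (λ S → ∧-zeroʳ _) (allSubsets n)) (countᵇ-none (allSubsets n)))
    (countᵇ-cliqueIn (tail₂ A) (P ∘ suc) zero))
countᵇ-cliqueIn {suc n} A P (suc k) = trans
  (countᵇ-subsets (λ S → cliqueIn A P S ∧ (∣ S ∣ ≡ᵇ suc k)))
  (cong₂ _+_ (with-zero (P zero)) (countᵇ-cliqueIn (tail₂ A) (P ∘ suc) (suc k)))
  where
  with-zero : ∀ b → countᵇ (λ S → (b ∧ cliqueIn (tail₂ A) ((P ∩ A zero) ∘ suc) S) ∧ (∣ S ∣ ≡ᵇ k)) (allSubsets n)
    ≡ ⟦ b ⟧ * cliques (tail₂ A) ((P ∩ A zero) ∘ suc) k
  with-zero true  = trans (countᵇ-cliqueIn (tail₂ A) ((P ∩ A zero) ∘ suc) k) (sym (*-identityˡ _))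
  with-zero false = countᵇ-none (allSubsets n)

∧-true : ∀ {a b} → a ∧ b ≡ true → a ≡ true × b ≡ true
∧-true {true} e = refl , e

∧-intro : ∀ {a b} → a ≡ true → b ≡ true → a ∧ b ≡ true
∧-intro refl e = e

CliqueIn : ∀ {n} → Rel₂ n → (Fin n → Bool) → Subset n → Set
CliqueIn A P S = (∀ i → lookup S i ≡ true → P i ≡ true) ×
  (∀ i j → lookup S i ≡ true → lookup S j ≡ true → i ≢ j → A i j ≡ true)

cliqueIn-sound : ∀ {n} (A : Rel₂ n) → Symmetric₂ A → ∀ P S → cliqueIn A P S ≡ true → CliqueIn A P S
cliqueIn-sound A A-sym P [] e = (λ ()) , (λ ())
cliqueIn-sound A A-sym P (true ∷ S) e with ∧-true {P zero} e
... | p₀ , e′ with cliqueIn-sound (tail₂ A) (λ i j → A-sym _ _) _ S e′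
... | sub , adjacent = sub′ , adjacent′
  where
  sub′ : ∀ i → lookup (true ∷ S) i ≡ true → P i ≡ true
  sub′ zero _ = p₀
  sub′ (suc i) m = proj₁ (∧-true (sub i m))
  adjacent′ : ∀ i j → lookup (true ∷ S) i ≡ true → lookup (true ∷ S) j ≡ true → i ≢ j → A i j ≡ true
  adjacent′ zero zero _ _ i≢j = ⊥-elim (i≢j refl)
  adjacent′ zero (suc j) _ m _ = proj₂ (∧-true {P (suc j)} (sub j m))
  adjacent′ (suc i) zero m _ _ = trans (A-sym _ _) (proj₂ (∧-true {P (suc i)} (sub i m)))
  adjacent′ (suc i) (suc j) m m′ i≢j = adjacent i j m m′ (i≢j ∘ cong suc)
cliqueIn-sound A A-sym P (false ∷ S) e with cliqueIn-sound (tail₂ A) (λ i j → A-sym _ _) _ S e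
... | sub , adjacent = sub′ , adjacent′
  where
  sub′ : ∀ i → lookup (false ∷ S) i ≡ true → P i ≡ true
  sub′ (suc i) m = sub i m
  adjacent′ : ∀ i j → lookup (false ∷ S) i ≡ true → lookup (false ∷ S) j ≡ true → i ≢ j → A i j ≡ true
  adjacent′ (suc i) (suc j) m m′ i≢j = adjacent i j m m′ (i≢j ∘ cong suc)

cliqueIn-complete : ∀ {n} (A : Rel₂ n) P S → CliqueIn A P S → cliqueIn A P S ≡ true
cliqueIn-complete A P [] c = refl
cliqueIn-complete A P (true ∷ S) (sub , adjacent) = ∧-intro (sub zero refl)
  (cliqueIn-complete (tail₂ A) _ S
    ( (λ i m → ∧-intro (sub (suc i) m) (adjacent zero (suc i) refl m (λ ())))
    , λ i j m m′ i≢j → adjacent (suc i) (suc j) m m′ (i≢j ∘ suc-injectiveᶠ)))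
cliqueIn-complete A P (false ∷ S) (sub , adjacent) = cliqueIn-complete (tail₂ A) _ S
  ( (λ i → sub (suc i)) , λ i j m m′ i≢j → adjacent (suc i) (suc j) m m′ (i≢j ∘ suc-injectiveᶠ))

memᵇ≡lookup : ∀ {n} (i : Fin n) S → memᵇ i S ≡ lookup S i
memᵇ≡lookup i S with lookup S i
... | true  = refl
... | false = refl

allᵇ-sound : {X : Set} (p : X → Bool) → ∀ xs → allᵇ p xs ≡ true → ∀ {x} → x ∈ˡ xs → p x ≡ true
allᵇ-sound p (x ∷ xs) e (here refl) = proj₁ (∧-true e)
allᵇ-sound p (x ∷ xs) e (there x∈) = allᵇ-sound p xs (proj₂ (∧-true {p x} e)) x∈

allᵇ-complete : {X : Set} (p : X → Bool) → (∀ x → p x ≡ true) → ∀ xs → allᵇ p xs ≡ true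
allᵇ-complete p h [] = refl
allᵇ-complete p h (x ∷ xs) = ∧-intro (h x) (allᵇ-complete p h xs)

isCliqueᵇ≡cliqueIn : ∀ {n} (G : Graph n) S → isCliqueᵇ G S ≡ cliqueIn (adj G) full S
isCliqueᵇ≡cliqueIn {n} G S = ⇔→≡ {z = true} (mk⇔ to from)
  where
  test : Rel₂ n
  test i j = not (memᵇ i S ∧ memᵇ j S ∧ not (does (i ≟ j))) ∨ adj G i j
  to : isCliqueᵇ G S ≡ true → cliqueIn (adj G) full S ≡ true
  to e = cliqueIn-complete (adj G) full S ((λ _ _ → refl) , adjacent)
    where
    adjacent : ∀ i j → lookup S i ≡ true → lookup S j ≡ true → i ≢ j → adj G i j ≡ true
    adjacent i j m m′ i≢j
      with allᵇ-sound (test i) (allFin n)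
             (allᵇ-sound (λ i → allᵇ (test i) (allFin n)) (allFin n) e (∈-allFin i)) (∈-allFin j)
    ... | t rewrite memᵇ≡lookup i S | memᵇ≡lookup j S | m | m′ with i ≟ j
    ... | yes i≡j = ⊥-elim (i≢j i≡j)
    ... | no _    = t
  from : cliqueIn (adj G) full S ≡ true → isCliqueᵇ G S ≡ true
  from e = allᵇ-complete _ (λ i → allᵇ-complete _ (λ j → passes i j) (allFin n)) (allFin n)
    where
    passes : ∀ i j → test i j ≡ true
    passes i j rewrite memᵇ≡lookup i S | memᵇ≡lookup j S with lookup S i in m | lookup S j in m′ | i ≟ j
    ... | false | _     | _     = refl
    ... | true  | false | _     = refl
    ... | true  | true  | yes _ = refl
    ... | true  | true  | no i≢j = proj₂ (cliqueIn-sound (adj G) (Graph.sym G) full S e) i j m m′ i≢j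

cliqueCount≡cliques : ∀ {n} k (G : Graph n) → cliqueCount k G ≡ cliques (adj G) full k
cliqueCount≡cliques {n} k G = trans
  (countᵇ-cong (λ S → cong (_∧ (∣ S ∣ ≡ᵇ k)) (isCliqueᵇ≡cliqueIn G S)) (allSubsets n))
  (countᵇ-cliqueIn (adj G) full k)

!*cliqueCount : ∀ {n} k (G : Graph n) → k ! * cliqueCount k G ≡ cliqueTuples (adj G) full k
!*cliqueCount k G = trans (cong (k ! *_) (cliqueCount≡cliques k G))
  (!*cliques≡cliqueTuples (adj G) (Graph.sym G) (Graph.irrefl G) full k)

-- Sums over cyclic labellings

sum-const : ∀ n x → sum {n} (λ _ → x) ≡ n * x
sum-const zero    x = refl
sum-const (suc n) x = cong (x +_) (sum-const n x)

term≤sum : ∀ {n} (f : Fin n → ℕ) i → f i ≤ sum f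
term≤sum f zero    = m≤m+n (f zero) _
term≤sum f (suc i) = ≤-trans (term≤sum (f ∘ suc) i) (m≤n+m _ (f zero))

-- Accounts for a vertex `v` missing from its own neighbourhood: that costs at most one.
sum-mono-except : ∀ {n} {f g : Fin n → ℕ} v → (∀ u → u ≢ v → f u ≤ g u) → f v ≤ suc (g v) →
  sum f ≤ suc (sum g)
sum-mono-except zero    h hv = +-mono-≤ hv (sum-mono (λ u → h (suc u) (λ ())))
sum-mono-except {f = f} {g} (suc v) h hv = begin
  f zero + sum (f ∘ suc)       ≤⟨ +-mono-≤ (h zero (λ ())) (sum-mono-except v (λ u u≢v → h (suc u) (u≢v ∘ suc-injectiveᶠ)) hv) ⟩
  g zero + suc (sum (g ∘ suc)) ≡⟨ +-suc (g zero) _ ⟩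
  suc (g zero + sum (g ∘ suc)) ∎
  where open ≤-Reasoning

sum-+ : ∀ m n (g : ℕ → ℕ) →
  sum {m + n} (g ∘ toℕ) ≡ sum {m} (g ∘ toℕ) + sum {n} (λ i → g (m + toℕ i))
sum-+ zero    n g = refl
sum-+ (suc m) n g = trans (cong (g 0 +_) (sum-+ m n (g ∘ suc))) (sym (+-assoc (g 0) _ _))

sum-prefix : ∀ {m n} → m ≤ n → (g : ℕ → ℕ) → sum {m} (g ∘ toℕ) ≤ sum {n} (g ∘ toℕ)
sum-prefix {m} {n} m≤n g = subst (λ x → sum {m} (g ∘ toℕ) ≤ sum {x} (g ∘ toℕ)) (m+[n∸m]≡n m≤n)
  (≤-trans (m≤m+n _ _) (≤-reflexive (sym (sum-+ m (n ∸ m) g))))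

sum-periodic : ∀ m s (g : ℕ → ℕ) → (∀ i → g (m + i) ≡ g i) →
  sum {s * m} (g ∘ toℕ) ≡ s * sum {m} (g ∘ toℕ)
sum-periodic m zero    g per = refl
sum-periodic m (suc s) g per = trans (sum-+ m (s * m) g) (cong (sum {m} (g ∘ toℕ) +_)
  (trans (sum-cong-≗ {s * m} (λ i → per (toℕ i))) (sum-periodic m s g per)))

toℕ-mod : ∀ i m .{{_ : NonZero m}} → toℕ (i mod m) ≡ i % m
toℕ-mod i m = toℕ-fromℕ< (m%n<n i m)

module _ {m} .{{_ : NonZero m}} (f : Fin m → ℕ) where

  sum-mod : ∀ s → sum {s * m} (λ i → f (toℕ i mod m)) ≡ s * sum f
  sum-mod s = trans
    (sum-periodic m s (λ i → f (i mod m)) (λ i → cong f (toℕ-injective (trans (toℕ-mod (m + i) m)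
      (trans (cong (_% m) (+-comm m i)) (trans ([m+n]%n≡m%n i m) (sym (toℕ-mod i m))))))))
    (cong (s *_) (sum-cong-≗ (λ a → cong f (toℕ-injective
      (trans (toℕ-mod (toℕ a) m) (m<n⇒m%n≡m (toℕ<n a)))))))

  sum-mod-≤ : ∀ {n} s → n ≤ s * m → sum {n} (λ i → f (toℕ i mod m)) ≤ s * sum f
  sum-mod-≤ s n≤sm = ≤-trans (sum-prefix n≤sm (λ i → f (i mod m))) (≤-reflexive (sum-mod s))

  sum-mod-≥ : ∀ {n} s → s * m ≤ n → s * sum f ≤ sum {n} (λ i → f (toℕ i mod m))
  sum-mod-≥ s sm≤n = ≤-trans (≤-reflexive (sym (sum-mod s))) (sum-prefix sm≤n (λ i → f (i mod m)))

-- Upper and lower bounds for clique tuples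

-- A homomorphism carries clique tuples to clique tuples, at most M^k to one if its fibres have at
-- most `M` elements. `fibres` states this size bound for arbitrary weights `f`, the form in which
-- the induction consumes it.
cliqueTuples-hom : ∀ {n m} (A : Rel₂ n) (R : Rel₂ m) (c : Fin n → Fin m) M →
  (∀ f → sum (f ∘ c) ≤ M * sum f) → (∀ u v → A u v ≡ true → R (c u) (c v) ≡ true) →
  ∀ k P Q → (∀ v → P v ≡ true → Q (c v) ≡ true) →
  cliqueTuples A P k ≤ M ^ k * cliqueTuples R Q k
cliqueTuples-hom A R c M fibres hom zero P Q P⇒Q = ≤-refl
cliqueTuples-hom A R c M fibres hom (suc k) P Q P⇒Q = begin
  sum (λ v → ⟦ P v ⟧ * cliqueTuples A (P ∩ A v) k)     ≤⟨ sum-mono pointwise ⟩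
  sum (λ v → M ^ k * f (c v))                          ≡⟨ *-distribˡ-sum (M ^ k) (f ∘ c) ⟨
  M ^ k * sum (f ∘ c)                                  ≤⟨ *-monoʳ-≤ (M ^ k) (fibres f) ⟩
  M ^ k * (M * sum f)                                  ≡⟨ arrange (M ^ k) M (sum f) ⟩
  M ^ suc k * sum f                                    ∎
  where
  open ≤-Reasoning
  f : Fin _ → ℕ
  f a = ⟦ Q a ⟧ * cliqueTuples R (Q ∩ R a) k
  arrange : ∀ a b c → a * (b * c) ≡ (b * a) * c
  arrange = solve-∀
  pointwise : ∀ v → ⟦ P v ⟧ * cliqueTuples A (P ∩ A v) k ≤ M ^ k * f (c v)
  pointwise v with P v in Pv
  ... | false = z≤n
  ... | true rewrite P⇒Q v Pv = begin
    1 * cliqueTuples A (P ∩ A v) k                    ≡⟨ *-identityˡ _ ⟩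
    cliqueTuples A (P ∩ A v) k                        ≤⟨ cliqueTuples-hom A R c M fibres hom k _ (Q ∩ R (c v))
         (λ u e → ∧-intro (P⇒Q u (proj₁ (∧-true e))) (hom v u (proj₂ (∧-true {P u} e)))) ⟩
    M ^ k * cliqueTuples R (Q ∩ R (c v)) k            ≡⟨ cong (M ^ k *_) (*-identityˡ _) ⟨
    M ^ k * (1 * cliqueTuples R (Q ∩ R (c v)) k)      ∎

-- Each chosen vertex removes at most itself from the candidates. The falling factorial is weakened
-- to a plain power, which changes only lower-order terms.
cliqueTuples-complete : ∀ {n} (A : Rel₂ n) k P s →
  (∀ u v → P u ≡ true → P v ≡ true → u ≢ v → A u v ≡ true) →
  s ≤ sum (⟦_⟧ ∘ P) → (s ∸ k) ^ k ≤ cliqueTuples A P k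
cliqueTuples-complete A zero    P s       complete s≤ = ≤-refl
cliqueTuples-complete A (suc k) P zero    complete s≤ = z≤n
cliqueTuples-complete A (suc k) P (suc s) complete s≤ = begin
  (s ∸ k) * X                       ≤⟨ *-monoˡ-≤ X (≤-trans (m∸n≤m s k) (≤-trans (n≤1+n s) s≤)) ⟩
  sum (⟦_⟧ ∘ P) * X                 ≡⟨ *-distribʳ-sum X (⟦_⟧ ∘ P) ⟩
  sum (λ v → ⟦ P v ⟧ * X)           ≤⟨ sum-mono pointwise ⟩
  cliqueTuples A P (suc k)          ∎
  where
  open ≤-Reasoning
  X = (s ∸ k) ^ k
  pointwise : ∀ v → ⟦ P v ⟧ * X ≤ ⟦ P v ⟧ * cliqueTuples A (P ∩ A v) k
  pointwise v with P v in Pv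
  ... | false = z≤n
  ... | true  = *-monoʳ-≤ 1 (cliqueTuples-complete A k (P ∩ A v) s
    (λ u w e e′ → complete u w (proj₁ (∧-true e)) (proj₁ (∧-true e′)))
    (s≤s⁻¹ (≤-trans s≤ (sum-mono-except v survives (⟦⟧≤suc (P v) _)))))
    where
    survives : ∀ u → u ≢ v → ⟦ P u ⟧ ≤ ⟦ P u ∧ A v u ⟧
    survives u u≢v with P u in Pu
    ... | false = z≤n
    ... | true rewrite complete v u Pv Pu (u≢v ∘ sym) = ≤-refl

≡ᵇ-sound : ∀ a b → (a ≡ᵇ b) ≡ true → a ≡ b
≡ᵇ-sound a b e = ≡ᵇ⇒≡ a b (subst T (sym e) _)

≡ᵇ-refl : ∀ a → (a ≡ᵇ a) ≡ true
≡ᵇ-refl zero    = refl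
≡ᵇ-refl (suc a) = ≡ᵇ-refl a

-- The first entry is free; the others come from its part without it, which has at least `n / r ∸ 1`
-- vertices. That vertex and the k lost in `cliqueTuples-complete` make up `suc k`.
cliqueTuples-turán : ∀ n r k .{{_ : NonZero r}} →
  n * (n / r ∸ suc k) ^ k ≤ cliqueTuples (adj (turanComplement n r)) full (suc k)
cliqueTuples-turán n r@(suc _) k = begin
  n * (n / r ∸ suc k) ^ k                       ≡⟨ sum-const n _ ⟨
  sum {n} (λ _ → (n / r ∸ suc k) ^ k)           ≤⟨ sum-mono pointwise ⟩
  sum (λ v → 1 * cliqueTuples A (A v) k)        ∎
  where
  open ≤-Reasoning
  A = adj (turanComplement n r)
  adjacent : ∀ u w → part r u ≡ part r w → u ≢ w → A u w ≡ true
  adjacent u w same u≢w rewrite same | dec-false (u ≟ w) u≢w = trans (∧-identityʳ _) (≡ᵇ-refl (part r w))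
  same-part : ∀ u w → A u w ≡ true → part r u ≡ part r w
  same-part u w e = ≡ᵇ-sound _ _ (proj₁ (∧-true e))
  degree : ∀ v → n / r ≤ suc (sum (λ u → ⟦ A v u ⟧))
  degree v = begin
    n / r                                  ≡⟨ *-identityʳ (n / r) ⟨
    n / r * 1                              ≤⟨ *-monoʳ-≤ (n / r) (≤-trans (≤-reflexive (sym hit)) (term≤sum f (toℕ v mod r))) ⟩
    n / r * sum f                          ≤⟨ sum-mod-≥ f (n / r) (m/n*n≤m n r) ⟩
    sum {n} (λ u → f (toℕ u mod r))        ≤⟨ sum-mono-except v agrees (⟦⟧≤suc (part r v ≡ᵇ toℕ (toℕ v mod r)) _) ⟩
    suc (sum (λ u → ⟦ A v u ⟧))            ∎
    where
    f : Fin r → ℕ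
    f a = ⟦ part r v ≡ᵇ toℕ a ⟧
    toℕ-mod-r : ∀ i → toℕ (i mod r) ≡ i % r
    toℕ-mod-r i = toℕ-mod i r
    hit : f (toℕ v mod r) ≡ 1
    hit rewrite toℕ-mod-r (toℕ v) | ≡ᵇ-refl (part r v) = refl
    agrees : ∀ u → u ≢ v → f (toℕ u mod r) ≤ ⟦ A v u ⟧
    agrees u u≢v rewrite toℕ-mod-r (toℕ u) | dec-false (v ≟ u) (u≢v ∘ sym) =
      ≤-reflexive (cong ⟦_⟧ (sym (∧-identityʳ (part r v ≡ᵇ part r u))))
  pointwise : ∀ v → (n / r ∸ suc k) ^ k ≤ 1 * cliqueTuples A (A v) k
  pointwise v = begin
    (n / r ∸ suc k) ^ k           ≡⟨ cong (_^ k) (∸-+-assoc (n / r) 1 k) ⟨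
    (n / r ∸ 1 ∸ k) ^ k           ≤⟨ cliqueTuples-complete A k (A v) (n / r ∸ 1)
      (λ u w e e′ → adjacent u w (trans (sym (same-part v u e)) (same-part v w e′)))
      (m≤n+o⇒m∸n≤o _ 1 (degree v)) ⟩
    cliqueTuples A (A v) k        ≡⟨ *-identityˡ _ ⟨
    1 * cliqueTuples A (A v) k    ∎

-- Comparison of blow-ups with the complement of the Turán graph

-- This is (x + d)^k ≤ x^k (1 + C / x) with a C that does not depend on x, multiplied by x to avoid
-- division.
shift-power : ∀ d k → ∃ λ C → ∀ x → 1 ≤ x → (x + d) ^ k * x ≤ x ^ k * (x + C)
shift-power d zero    = 0 , λ x _ → ≤-reflexive (cong (1 *_) (sym (+-identityʳ x)))
shift-power d (suc k) with shift-power d k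
... | C , bound = d + C + d * C , λ x 1≤x → begin
  (x + d) * (x + d) ^ k * x                  ≡⟨ *-assoc (x + d) _ x ⟩
  (x + d) * ((x + d) ^ k * x)                ≤⟨ *-monoʳ-≤ (x + d) (bound x 1≤x) ⟩
  (x + d) * (x ^ k * (x + C))                ≡⟨ expand x d (x ^ k) C ⟩
  x ^ k * (x * (x + d + C) + d * C * 1)      ≤⟨ *-monoʳ-≤ (x ^ k) (+-monoʳ-≤ (x * (x + d + C)) (*-monoʳ-≤ (d * C) 1≤x)) ⟩
  x ^ k * (x * (x + d + C) + d * C * x)      ≡⟨ collect x d (x ^ k) C ⟩
  x * x ^ k * (x + (d + C + d * C))          ∎
  where
  open ≤-Reasoning
  expand : ∀ x d p C → (x + d) * (p * (x + C)) ≡ p * (x * (x + d + C) + d * C * 1)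
  expand = solve-∀
  collect : ∀ x d p C → p * (x * (x + d + C) + d * C * x) ≡ x * p * (x + (d + C + d * C))
  collect = solve-∀

-- As soon as x exceeds a C, a (1 + C / x) is below a + 1, hence below or equal to b. The strict gap
-- between integers is what beats the shift `d`.
shift-power-< : ∀ {a b} d k → a < b → ∃ λ X → ∀ x → X ≤ x → a * (x + d) ^ k < b * x ^ k
shift-power-< {a} {b} d k a<b with shift-power d k
... | C , bound = suc (a * C) , λ { x@(suc _) aC<x → *-cancelʳ-< x _ _ (begin-strict
  a * (x + d) ^ k * x            ≡⟨ *-assoc a _ x ⟩
  a * ((x + d) ^ k * x)          ≤⟨ *-monoʳ-≤ a (bound x (s≤s z≤n)) ⟩
  a * (x ^ k * (x + C))          ≡⟨ expand a (x ^ k) x C ⟩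
  x ^ k * (a * x + a * C)        <⟨ *-monoʳ-< (x ^ k) {{m^n≢0 x k}} (+-monoʳ-< (a * x) aC<x) ⟩
  x ^ k * (a * x + x)            ≡⟨ collect a (x ^ k) x ⟩
  suc a * x ^ k * x              ≤⟨ *-monoˡ-≤ x (*-monoˡ-≤ (x ^ k) a<b) ⟩
  b * x ^ k * x                  ∎) }
  where
  open ≤-Reasoning
  expand : ∀ a p x C → a * (p * (x + C)) ≡ p * (a * x + a * C)
  expand = solve-∀
  collect : ∀ a p x → p * (a * x + x) ≡ suc a * p * x
  collect = solve-∀

^-distrib-* : ∀ a b k → (a * b) ^ k ≡ a ^ k * b ^ k
^-distrib-* a b zero    = refl
^-distrib-* a b (suc k) = trans (cong (a * b *_) (^-distrib-* a b k)) (arrange a b (a ^ k) (b ^ k))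
  where
  arrange : ∀ a b c d → a * b * (c * d) ≡ a * c * (b * d)
  arrange = solve-∀

-- Lists may repeat entries, so a non-loop x would give independent lists x, x, ... of every length.
-- A bound on the lengths thus forces `R` to be reflexive, and then independent lists have distinct
-- entries.
Independent : {X : Set} → (X → X → Bool) → List X → Set
Independent R = AllPairs (λ x y → R x y ≡ false)

module _ {m} .{{_ : NonZero m}} (R : Rel₂ m) (R-sym : Symmetric₂ R) where

  blowUp : ∀ n → Graph n
  blowUp n = record { adj = A ; sym = A-sym ; irrefl = A-irr }
    where
    A : Rel₂ n
    A u v = R (toℕ u mod m) (toℕ v mod m) ∧ not (does (u ≟ v))
    A-sym : Symmetric₂ A
    A-sym u v with u ≟ v | v ≟ u
    ... | yes _   | yes _   = cong (_∧ false) (R-sym _ _)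
    ... | no _    | no _    = cong (_∧ true) (R-sym _ _)
    ... | yes u≡v | no v≢u  = ⊥-elim (v≢u (sym u≡v))
    ... | no u≢v  | yes v≡u = ⊥-elim (u≢v (sym v≡u))
    A-irr : ∀ u → A u u ≡ false
    A-irr u with u ≟ u
    ... | yes _  = ∧-zeroʳ _
    ... | no u≢u = ⊥-elim (u≢u refl)

  cliqueTuples-blowUp : ∀ n k → cliqueTuples (adj (blowUp n)) full k ≤ suc (n / m) ^ k * cliqueTuples R full k
  cliqueTuples-blowUp n k = cliqueTuples-hom (adj (blowUp n)) R (λ u → toℕ u mod m) (suc (n / m))
    (λ f → sum-mod-≤ f (suc (n / m)) (begin
      n                     ≡⟨ m≡m%n+[m/n]*n n m ⟩
      n % m + n / m * m     ≤⟨ +-monoˡ-≤ _ (<⇒≤ (m%n<n n m)) ⟩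
      m + n / m * m         ∎))
    (λ u v e → proj₁ (∧-true e)) k full full (λ _ _ → refl)
    where open ≤-Reasoning

  blowUp-beats-turán : ∀ r k .{{_ : NonZero r}} → r ^ k * cliqueTuples R full (suc k) < m ^ suc k →
    ∃ λ N → ∀ n → N ≤ n → cliqueCount (suc k) (blowUp n) < cliqueCount (suc k) (turanComplement n r)
  blowUp-beats-turán r k few = X + c , λ n N≤n → beats n N≤n
    where
    open ≤-Reasoning
    h = cliqueTuples R full (suc k)
    K = suc k
    -- Everything is expressed in x = n - c. Of the k + 2 multiples of r, k + 1 pay for the
    -- subtraction of `K` in `n / r ∸ K` and one for the rounding of `n / r`, so that x ≤ r (n / r -
    -- K); on the other side m (n / m + 1) ≤ x + (c + m).
    c = r * (2 + k)
    large = shift-power-< (c + m) K few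
    X = proj₁ large
    tuples< : ∀ n → X + c ≤ n → suc (n / m) ^ K * h < n * (n / r ∸ K) ^ k
    tuples< n N≤n = *-cancelˡ-< (m ^ K * r ^ k) _ _ (begin-strict
      m ^ K * r ^ k * (M ^ K * h)           ≡⟨ arrange (m ^ K) (r ^ k) (M ^ K) h ⟩
      r ^ k * h * (m ^ K * M ^ K)           ≡⟨ cong (r ^ k * h *_) (^-distrib-* m M K) ⟨
      r ^ k * h * (m * M) ^ K               ≤⟨ *-monoʳ-≤ (r ^ k * h) (^-monoˡ-≤ K mM≤) ⟩
      r ^ k * h * (x + (c + m)) ^ K         <⟨ proj₂ large x (m+n≤o⇒m≤o∸n X N≤n) ⟩
      m ^ K * (x * x ^ k)                   ≤⟨ *-monoʳ-≤ (m ^ K) (*-mono-≤ (m∸n≤m n c) (^-monoˡ-≤ k x≤)) ⟩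
      m ^ K * (n * (r * y) ^ k)             ≡⟨ cong (λ z → m ^ K * (n * z)) (^-distrib-* r y k) ⟩
      m ^ K * (n * (r ^ k * y ^ k))         ≡⟨ arrange′ (m ^ K) n (r ^ k) (y ^ k) ⟩
      m ^ K * r ^ k * (n * y ^ k)           ∎)
      where
      M = suc (n / m)
      x = n ∸ c
      y = n / r ∸ K
      arrange : ∀ a b c d → a * b * (c * d) ≡ b * d * (a * c)
      arrange = solve-∀
      arrange′ : ∀ a b c d → a * (b * (c * d)) ≡ a * c * (b * d)
      arrange′ = solve-∀
      mM≤ : m * M ≤ x + (c + m)
      mM≤ = begin
        m * suc (n / m)      ≡⟨ *-comm m _ ⟩
        m + n / m * m        ≤⟨ +-monoʳ-≤ m (m/n*n≤m n m) ⟩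
        m + n                ≡⟨ +-comm m n ⟩
        n + m                ≡⟨ cong (_+ m) (m∸n+n≡m (m+n≤o⇒n≤o X N≤n)) ⟨
        x + c + m            ≡⟨ +-assoc x c m ⟩
        x + (c + m)          ∎
      x≤ : x ≤ r * y
      x≤ = begin
        n ∸ r * (2 + k)                    ≡⟨ cong (n ∸_) (*-suc r K) ⟩
        n ∸ (r + r * K)                    ≤⟨ ∸-monoˡ-≤ (r + r * K) n≤ ⟩
        (r + r * (n / r)) ∸ (r + r * K)    ≡⟨ [m+n]∸[m+o]≡n∸o r _ _ ⟩
        r * (n / r) ∸ r * K                ≡⟨ *-distribˡ-∸ r (n / r) K ⟨
        r * (n / r ∸ K)                    ∎
        where
        n≤ : n ≤ r + r * (n / r)
        n≤ = begin
          n                        ≡⟨ m≡m%n+[m/n]*n n r ⟩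
          n % r + n / r * r        ≤⟨ +-mono-≤ (<⇒≤ (m%n<n n r)) (≤-reflexive (*-comm (n / r) r)) ⟩
          r + r * (n / r)          ∎
    beats : ∀ n → X + c ≤ n → cliqueCount K (blowUp n) < cliqueCount K (turanComplement n r)
    beats n N≤n = *-cancelˡ-< (K !) _ _ (begin-strict
      K ! * cliqueCount K (blowUp n)                    ≡⟨ !*cliqueCount K (blowUp n) ⟩
      cliqueTuples (adj (blowUp n)) full K              ≤⟨ cliqueTuples-blowUp n K ⟩
      suc (n / m) ^ K * h                               <⟨ tuples< n N≤n ⟩
      n * (n / r ∸ K) ^ k                               ≤⟨ cliqueTuples-turán n r k ⟩
      cliqueTuples (adj (turanComplement n r)) full K   ≡⟨ !*cliqueCount K (turanComplement n r) ⟨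
      K ! * cliqueCount K (turanComplement n r)         ∎)

  -- Vertices with the same label are adjacent through the loop at that label, so an independent set
  -- meets each label at most once and its labels form an independent list.
  blowUp-independence : ∀ r → (∀ xs → Independent R xs → length xs ≤ r) →
    ∀ n → IndepNumberLessThan (blowUp n) (suc r)
  blowUp-independence r bound n S indep = s≤s (subst (_≤ r) (length-labels label S)
    (bound (labels label S) (labels-allPairs label S non-adjacent)))
    where
    label : Fin n → Fin m
    label u = toℕ u mod m
    non-adjacent : ∀ i j → i ∈ S → j ∈ S → i ≢ j → R (label i) (label j) ≡ false
    non-adjacent i j i∈ j∈ i≢j with i ≟ j | indep i j i∈ j∈ i≢j
    ... | yes i≡j | _ = ⊥-elim (i≢j i≡j)
    ... | no _    | e = trans (sym (∧-identityʳ _)) e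
    labels : ∀ {n} → (Fin n → Fin m) → Subset n → List (Fin m)
    labels c []          = []
    labels c (true ∷ S)  = c zero ∷ labels (c ∘ suc) S
    labels c (false ∷ S) = labels (c ∘ suc) S
    length-labels : ∀ {n} (c : Fin n → Fin m) S → length (labels c S) ≡ ∣ S ∣
    length-labels c []          = refl
    length-labels c (true ∷ S)  = cong suc (length-labels (c ∘ suc) S)
    length-labels c (false ∷ S) = length-labels (c ∘ suc) S
    labels-all : ∀ {n} {Z : Fin m → Set} (c : Fin n → Fin m) S → (∀ i → i ∈ S → Z (c i)) → All Z (labels c S)
    labels-all c []          z = []
    labels-all c (true ∷ S)  z = z zero here ∷ labels-all (c ∘ suc) S (λ i i∈ → z (suc i) (there i∈))
    labels-all c (false ∷ S) z = labels-all (c ∘ suc) S (λ i i∈ → z (suc i) (there i∈))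
    labels-allPairs : ∀ {n} {Z : Fin m → Fin m → Set} (c : Fin n → Fin m) S →
      (∀ i j → i ∈ S → j ∈ S → i ≢ j → Z (c i) (c j)) → AllPairs Z (labels c S)
    labels-allPairs c []          z = []
    labels-allPairs c (true ∷ S)  z = labels-all (c ∘ suc) S (λ i i∈ → z zero (suc i) here (there i∈) (λ ()))
      ∷ labels-allPairs (c ∘ suc) S (λ i j i∈ j∈ i≢j → z (suc i) (suc j) (there i∈) (there j∈) (i≢j ∘ suc-injectiveᶠ))
    labels-allPairs c (false ∷ S) z =
      labels-allPairs (c ∘ suc) S (λ i j i∈ j∈ i≢j → z (suc i) (suc j) (there i∈) (there j∈) (i≢j ∘ suc-injectiveᶠ))

cliqueTuples-cong : ∀ {n} (A : Rel₂ n) k {P Q} → P ≗ Q → cliqueTuples A P k ≡ cliqueTuples A Q k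
cliqueTuples-cong A zero    P≗Q = refl
cliqueTuples-cong A (suc k) P≗Q = sum-cong-≗ (λ v → cong₂ _*_ (cong ⟦_⟧ (P≗Q v))
  (cliqueTuples-cong A k (λ u → cong (_∧ A v u) (P≗Q u))))

cliqueTuples-≤ : ∀ {n} (A : Rel₂ n) k P → cliqueTuples A P k ≤ n ^ k
cliqueTuples-≤ A zero P = ≤-refl
cliqueTuples-≤ {n} A (suc k) P = begin
  sum (λ v → ⟦ P v ⟧ * cliqueTuples A (P ∩ A v) k)
    ≤⟨ sum-mono (λ v → ≤-trans (⟦⟧*≤ (P v) _) (cliqueTuples-≤ A k (P ∩ A v))) ⟩
  sum {n} (λ _ → n ^ k)     ≡⟨ sum-const n (n ^ k) ⟩
  n * n ^ k                 ∎
  where open ≤-Reasoning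

sum-split : ∀ a {b} (f : Fin (a + b) → ℕ) → sum f ≡ sum (f ∘ (_↑ˡ b)) + sum (f ∘ (a ↑ʳ_))
sum-split zero    f = refl
sum-split (suc a) f = trans (cong (f zero +_) (sum-split a (f ∘ suc))) (sym (+-assoc (f zero) _ _))

sum-zero : ∀ {n} {f : Fin n → ℕ} → (∀ i → f i ≡ 0) → sum f ≡ 0
sum-zero {n} f≡0 = trans (sum-cong-≗ f≡0) (trans (sum-const n 0) (*-zeroʳ n))

-- Disjoint unions of relations

sumRel : {X Y : Set} → (X → X → Bool) → (Y → Y → Bool) → X ⊎ Y → X ⊎ Y → Bool
sumRel A B (inj₁ x) (inj₁ y) = A x y
sumRel A B (inj₁ x) (inj₂ y) = false
sumRel A B (inj₂ x) (inj₁ y) = false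
sumRel A B (inj₂ x) (inj₂ y) = B x y

_⊕_ : ∀ {a b} → Rel₂ a → Rel₂ b → Rel₂ (a + b)
_⊕_ {a} A B i j = sumRel A B (splitAt a i) (splitAt a j)

module _ {a b} (A : Rel₂ a) (B : Rel₂ b) where

  ⊕-sym : Symmetric₂ A → Symmetric₂ B → Symmetric₂ (A ⊕ B)
  ⊕-sym A-sym B-sym i j with splitAt a i | splitAt a j
  ... | inj₁ x | inj₁ y = A-sym x y
  ... | inj₁ x | inj₂ y = refl
  ... | inj₂ x | inj₁ y = refl
  ... | inj₂ x | inj₂ y = B-sym x y

  private
    left-left : ∀ i j → (A ⊕ B) (i ↑ˡ b) (j ↑ˡ b) ≡ A i j
    left-left i j rewrite splitAt-↑ˡ a i b | splitAt-↑ˡ a j b = refl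
    left-right : ∀ i j → (A ⊕ B) (i ↑ˡ b) (a ↑ʳ j) ≡ false
    left-right i j rewrite splitAt-↑ˡ a i b | splitAt-↑ʳ a b j = refl
    right-left : ∀ i j → (A ⊕ B) (a ↑ʳ i) (j ↑ˡ b) ≡ false
    right-left i j rewrite splitAt-↑ˡ a j b | splitAt-↑ʳ a b i = refl
    right-right : ∀ i j → (A ⊕ B) (a ↑ʳ i) (a ↑ʳ j) ≡ B i j
    right-right i j rewrite splitAt-↑ʳ a b i | splitAt-↑ʳ a b j = refl

    ∧-false : ∀ x {y} → y ≡ false → x ∧ y ≡ false
    ∧-false x refl = ∧-zeroʳ x

    cliqueTuples-left : ∀ k P → (∀ j → P (a ↑ʳ j) ≡ false) →
      cliqueTuples (A ⊕ B) P k ≡ cliqueTuples A (P ∘ (_↑ˡ b)) k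
    cliqueTuples-left zero    P none = refl
    cliqueTuples-left (suc k) P none = trans (sum-split a _) (trans (cong₂ _+_
      (sum-cong-≗ (λ i → cong (⟦ P (i ↑ˡ b) ⟧ *_) (trans
        (cliqueTuples-left k (P ∩ (A ⊕ B) (i ↑ˡ b)) (λ j → ∧-false (P (a ↑ʳ j)) (left-right i j)))
        (cliqueTuples-cong A k (λ j → cong (P (j ↑ˡ b) ∧_) (left-left i j))))))
      (sum-zero (λ j → cong (λ x → ⟦ x ⟧ * cliqueTuples (A ⊕ B) (P ∩ (A ⊕ B) (a ↑ʳ j)) k) (none j))))
      (+-identityʳ _))

    cliqueTuples-right : ∀ k P → (∀ i → P (i ↑ˡ b) ≡ false) →
      cliqueTuples (A ⊕ B) P k ≡ cliqueTuples B (P ∘ (a ↑ʳ_)) k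
    cliqueTuples-right zero    P none = refl
    cliqueTuples-right (suc k) P none = trans (sum-split a _) (cong₂ _+_
      (sum-zero (λ i → cong (λ x → ⟦ x ⟧ * cliqueTuples (A ⊕ B) (P ∩ (A ⊕ B) (i ↑ˡ b)) k) (none i)))
      (sum-cong-≗ (λ j → cong (⟦ P (a ↑ʳ j) ⟧ *_) (trans
        (cliqueTuples-right k (P ∩ (A ⊕ B) (a ↑ʳ j)) (λ i → ∧-false (P (i ↑ˡ b)) (right-left j i)))
        (cliqueTuples-cong B k (λ i → cong (P (a ↑ʳ i) ∧_) (right-right j i)))))))

  -- The first entry decides the side of the whole tuple. With no entries the empty tuple would be
  -- counted on both sides, hence `suc k`.
  cliqueTuples-⊕ : ∀ k →
    cliqueTuples (A ⊕ B) full (suc k) ≡ cliqueTuples A full (suc k) + cliqueTuples B full (suc k)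
  cliqueTuples-⊕ k = trans (sum-split a _) (cong₂ _+_
    (sum-cong-≗ (λ i → cong (1 *_) (trans
      (cliqueTuples-left k ((A ⊕ B) (i ↑ˡ b)) (left-right i)) (cliqueTuples-cong A k (left-left i)))))
    (sum-cong-≗ (λ j → cong (1 *_) (trans
      (cliqueTuples-right k ((A ⊕ B) (a ↑ʳ j)) (right-left j)) (cliqueTuples-cong B k (right-right j))))))

module _ {X Y : Set} (A : X → X → Bool) (B : Y → Y → Bool) where

  private
    lefts : List (X ⊎ Y) → List X
    lefts []            = []
    lefts (inj₁ x ∷ zs) = x ∷ lefts zs
    lefts (inj₂ y ∷ zs) = lefts zs

    rights : List (X ⊎ Y) → List Y
    rights []            = []
    rights (inj₁ x ∷ zs) = rights zs
    rights (inj₂ y ∷ zs) = y ∷ rights zs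

    length-split : ∀ zs → length zs ≡ length (lefts zs) + length (rights zs)
    length-split []            = refl
    length-split (inj₁ x ∷ zs) = cong suc (length-split zs)
    length-split (inj₂ y ∷ zs) = trans (cong suc (length-split zs)) (sym (+-suc (length (lefts zs)) _))

    lefts-all : ∀ {x zs} → All (λ z → sumRel A B (inj₁ x) z ≡ false) zs → All (λ y → A x y ≡ false) (lefts zs)
    lefts-all []                  = []
    lefts-all {zs = inj₁ _ ∷ _} (e ∷ es) = e ∷ lefts-all es
    lefts-all {zs = inj₂ _ ∷ _} (e ∷ es) = lefts-all es

    rights-all : ∀ {y zs} → All (λ z → sumRel A B (inj₂ y) z ≡ false) zs → All (λ x → B y x ≡ false) (rights zs)
    rights-all []                  = []
    rights-all {zs = inj₁ _ ∷ _} (e ∷ es) = rights-all es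
    rights-all {zs = inj₂ _ ∷ _} (e ∷ es) = e ∷ rights-all es

    lefts-independent : ∀ {zs} → Independent (sumRel A B) zs → Independent A (lefts zs)
    lefts-independent []                  = []
    lefts-independent {inj₁ _ ∷ _} (e ∷ es) = lefts-all e ∷ lefts-independent es
    lefts-independent {inj₂ _ ∷ _} (e ∷ es) = lefts-independent es

    rights-independent : ∀ {zs} → Independent (sumRel A B) zs → Independent B (rights zs)
    rights-independent []                  = []
    rights-independent {inj₁ _ ∷ _} (e ∷ es) = rights-independent es
    rights-independent {inj₂ _ ∷ _} (e ∷ es) = rights-all e ∷ rights-independent es

  sumRel-independence : ∀ {r s} → (∀ xs → Independent A xs → length xs ≤ r) →
    (∀ ys → Independent B ys → length ys ≤ s) → ∀ zs → Independent (sumRel A B) zs → length zs ≤ r + s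
  sumRel-independence {r} {s} α-A α-B zs ind = subst (_≤ r + s) (sym (length-split zs))
    (+-mono-≤ (α-A _ (lefts-independent ind)) (α-B _ (rights-independent ind)))

comap-independence : ∀ {X Y : Set} (R : Y → Y → Bool) (c : X → Y) {r} →
  (∀ ys → Independent R ys → length ys ≤ r) →
  ∀ xs → Independent (λ x x′ → R (c x) (c x′)) xs → length xs ≤ r
comap-independence R c α-R xs ind =
  subst (_≤ _) (length-map c xs) (α-R (map c xs) (map⁺ ind))

-- rel is meant to be reflexive, as its vertices become cliques in the blow-up; few says that the
-- (k+1)-clique density of the blow-ups is below r^(-k), that of r disjoint cliques.
record Pattern (r k : ℕ) : Set where
  field
    size         : ℕ
    rel          : Rel₂ size
    symmetric    : Symmetric₂ rel
    independence : ∀ xs → Independent rel xs → length xs ≤ r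
    few          : r ^ k * cliqueTuples rel full (suc k) < size ^ suc k

  size≢0 : NonZero size
  size≢0 = base≢0 size few
    where
    base≢0 : ∀ s {x} → x < s ^ suc k → NonZero s
    base≢0 (suc _) _ = _

pattern-beats-turán : ∀ r k .{{_ : NonZero r}} → Pattern r k →
  ∃ λ N → ∀ n → N ≤ n → Σ (Graph n) λ G → IndepNumberLessThan G (suc r) ×
    cliqueCount (suc k) G < cliqueCount (suc k) (turanComplement n r)
pattern-beats-turán r k pat = N , λ n N≤n →
  blowUp rel symmetric n , blowUp-independence rel symmetric r independence n , beats n N≤n
  where
  open Pattern pat
  instance
    size-nonZero : NonZero size
    size-nonZero = size≢0
  eventually = blowUp-beats-turán rel symmetric r k few
  N = proj₁ eventually
  beats = proj₂ eventually

-- Blowing the pattern up by r and adding a clique of the old size keeps all weights equal.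
pattern-suc : ∀ {r k} .{{_ : NonZero r}} → Pattern r k → Pattern (suc r) k
pattern-suc {r} {k} pat = record
  { size         = suc r * m
  ; rel          = complete ⊕ blown
  ; symmetric    = ⊕-sym complete blown (λ _ _ → refl) (λ i j → symmetric _ _)
  ; independence = comap-independence (sumRel complete blown) (splitAt m)
      (sumRel-independence complete blown α-complete (comap-independence rel label independence))
  ; few          = fewer
  }
  where
  open Pattern pat renaming (size to m)
  open ≤-Reasoning
  instance
    m-nonZero : NonZero m
    m-nonZero = size≢0
  K = suc k
  label : Fin (r * m) → Fin m
  label x = toℕ x mod m
  blown : Rel₂ (r * m)
  blown x y = rel (label x) (label y)
  complete : Rel₂ m
  complete _ _ = true
  α-complete : ∀ xs → Independent complete xs → length xs ≤ 1
  α-complete []          _               = z≤n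
  α-complete (x ∷ [])    _               = ≤-refl
  α-complete (x ∷ y ∷ _) ((() ∷ _) ∷ _)
  h = cliqueTuples rel full K
  count : cliqueTuples (complete ⊕ blown) full K ≤ m ^ K + r ^ K * h
  count = begin
    cliqueTuples (complete ⊕ blown) full K                   ≡⟨ cliqueTuples-⊕ complete blown k ⟩
    cliqueTuples complete full K + cliqueTuples blown full K
      ≤⟨ +-mono-≤ (cliqueTuples-≤ complete K full)
           (cliqueTuples-hom blown rel label r (λ f → sum-mod-≤ f r ≤-refl) (λ _ _ e → e) K full full (λ _ _ → refl)) ⟩
    m ^ K + r ^ K * h ∎
  fewer : suc r ^ k * cliqueTuples (complete ⊕ blown) full K < (suc r * m) ^ K
  fewer = begin-strict
    suc r ^ k * cliqueTuples (complete ⊕ blown) full K  ≤⟨ *-monoʳ-≤ (suc r ^ k) count ⟩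
    suc r ^ k * (m ^ K + r * r ^ k * h)                 ≡⟨ cong (λ x → suc r ^ k * (m ^ K + x)) (*-assoc r (r ^ k) h) ⟩
    suc r ^ k * (m ^ K + r * (r ^ k * h))
      <⟨ *-monoʳ-< (suc r ^ k) {{m^n≢0 (suc r) k}} (+-monoʳ-< (m ^ K) (*-monoʳ-< r few)) ⟩
    suc r ^ k * (suc r * m ^ K)                         ≡⟨ arrange (suc r ^ k) (suc r) (m ^ K) ⟩
    suc r ^ K * m ^ K                                   ≡⟨ ^-distrib-* (suc r) m K ⟨
    (suc r * m) ^ K                                     ∎
    where
    arrange : ∀ a b c → a * (b * c) ≡ (b * a) * c
    arrange = solve-∀

pattern-+ : ∀ {r k} j .{{_ : NonZero r}} → Pattern r k → Pattern (j + r) k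
pattern-+ zero pat = pat
pattern-+ {r@(suc _)} (suc j) pat = pattern-suc {{>-nonZero (≤-trans (s≤s z≤n) (m≤n+m r j))}} (pattern-+ j pat)

pattern-mono : ∀ {r r′ k} .{{_ : NonZero r}} → r ≤ r′ → Pattern r k → Pattern r′ k
pattern-mono {r} {r′} {k} r≤r′ pat = subst (λ x → Pattern x k) (m∸n+n≡m r≤r′) (pattern-+ (r′ ∸ r) pat)

-- The 5-cycle

-- The factor 4 is -1 modulo 5, so d is the difference of the two vertices: 0 gives the loops, 1 and
-- 4 the edges.
pentagon : Rel₂ 5
pentagon i j = (d ≡ᵇ 0) ∨ (d ≡ᵇ 1) ∨ (d ≡ᵇ 4)
  where d = (toℕ i + 4 * toℕ j) % 5

-- Inside a clique with loops no choice shrinks the candidate set, so all entries are free.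
cliqueTuples-clique : ∀ {n} (A : Rel₂ n) P → (∀ v → P v ≡ true → (P ∩ A v) ≗ P) →
  ∀ k → cliqueTuples A P k ≡ sum (⟦_⟧ ∘ P) ^ k
cliqueTuples-clique A P clique zero    = refl
cliqueTuples-clique A P clique (suc k) = trans (sum-cong-≗ pointwise) (sym (*-distribʳ-sum (sum (⟦_⟧ ∘ P) ^ k) (⟦_⟧ ∘ P)))
  where
  pointwise : ∀ v → ⟦ P v ⟧ * cliqueTuples A (P ∩ A v) k ≡ ⟦ P v ⟧ * sum (⟦_⟧ ∘ P) ^ k
  pointwise v with P v in Pv
  ... | false = refl
  ... | true  = cong (1 *_) (trans (cliqueTuples-cong A k (clique v Pv)) (cliqueTuples-clique A P clique k))

pentagon-sym : Symmetric₂ pentagon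
pentagon-sym = from-yes (all? λ i → all? λ j → pentagon i j Data.Bool.≟ pentagon j i)

pentagon-triple : ∀ x y z → pentagon x y ∨ pentagon x z ∨ pentagon y z ≡ true
pentagon-triple = from-yes (all? λ x → all? λ y → all? λ z →
  (pentagon x y ∨ pentagon x z ∨ pentagon y z) Data.Bool.≟ true)

pentagon-independence : ∀ xs → Independent pentagon xs → length xs ≤ 2
pentagon-independence []           _ = z≤n
pentagon-independence (_ ∷ [])     _ = s≤s z≤n
pentagon-independence (_ ∷ _ ∷ []) _ = ≤-refl
pentagon-independence (x ∷ y ∷ z ∷ _) ((xy ∷ xz ∷ _) ∷ (yz ∷ _) ∷ _)
  with pentagon-triple x y z
... | e rewrite xy | xz | yz with () ← e

-- The 5-cycle has no triangles, so the closed neighbourhoods of adjacent vertices meet only in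
-- these two vertices, and each further entry is one of them.
pentagon-edge : ∀ k v u → u ≢ v → pentagon v u ≡ true →
  cliqueTuples pentagon (pentagon v ∩ pentagon u) k ≡ 2 ^ k
pentagon-edge k v u u≢v e = trans
  (cliqueTuples-clique pentagon (pentagon v ∩ pentagon u) (λ w → clique v u w u≢v e) k)
  (cong (_^ k) (two v u u≢v e))
  where
  clique : ∀ v u w → u ≢ v → pentagon v u ≡ true → (pentagon v ∩ pentagon u) w ≡ true →
    (pentagon v ∩ pentagon u ∩ pentagon w) ≗ (pentagon v ∩ pentagon u)
  clique = from-yes (all? λ v → all? λ u → all? λ w →
    ¬? (u ≟ v) →-dec pentagon v u Data.Bool.≟ true →-dec (pentagon v ∩ pentagon u) w Data.Bool.≟ true →-dec
      (all? λ x → (pentagon v ∩ pentagon u ∩ pentagon w) x Data.Bool.≟ (pentagon v ∩ pentagon u) x))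
  two : ∀ v u → u ≢ v → pentagon v u ≡ true → sum (⟦_⟧ ∘ (pentagon v ∩ pentagon u)) ≡ 2
  two = from-yes (all? λ v → all? λ u →
    ¬? (u ≟ v) →-dec pentagon v u Data.Bool.≟ true →-dec
      sum (⟦_⟧ ∘ (pentagon v ∩ pentagon u)) Data.Nat.≟ 2)

pentagon-star : ∀ v X Y →
  sum (λ u → ⟦ pentagon v u ⟧ * (if does (u ≟ v) then X else Y)) ≡ X + 2 * Y
pentagon-star zero = s where
  s : ∀ X Y → 1 * X + (1 * Y + (0 + (0 + (1 * Y + 0)))) ≡ X + 2 * Y
  s = solve-∀
pentagon-star (suc zero) = s where
  s : ∀ X Y → 1 * Y + (1 * X + (1 * Y + (0 + (0 + 0)))) ≡ X + 2 * Y
  s = solve-∀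
pentagon-star (suc (suc zero)) = s where
  s : ∀ X Y → 0 + (1 * Y + (1 * X + (1 * Y + (0 + 0)))) ≡ X + 2 * Y
  s = solve-∀
pentagon-star (suc (suc (suc zero))) = s where
  s : ∀ X Y → 0 + (0 + (1 * Y + (1 * X + (1 * Y + 0)))) ≡ X + 2 * Y
  s = solve-∀
pentagon-star (suc (suc (suc (suc zero)))) = s where
  s : ∀ X Y → 1 * Y + (0 + (0 + (1 * Y + (1 * X + 0)))) ≡ X + 2 * Y
  s = solve-∀

-- An entry equal to `v` leaves the candidates unchanged, and either neighbour cuts them down to one
-- edge. The count therefore grows by 2 · 2^k at each step, from 1 up to 2^(k+1) - 1.
pentagon-neighbourhood : ∀ k v → suc (cliqueTuples pentagon (pentagon v) k) ≡ 2 ^ suc k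
pentagon-neighbourhood zero    v = refl
pentagon-neighbourhood (suc k) v = begin
  suc (sum (λ u → ⟦ pentagon v u ⟧ * cliqueTuples pentagon (pentagon v ∩ pentagon u) k))
    ≡⟨ cong suc (sum-cong-≗ pointwise) ⟩
  suc (sum (λ u → ⟦ pentagon v u ⟧ * (if does (u ≟ v) then X else 2 ^ k)))
    ≡⟨ cong suc (pentagon-star v X (2 ^ k)) ⟩
  suc X + 2 * 2 ^ k
    ≡⟨ cong (_+ 2 ^ suc k) (pentagon-neighbourhood k v) ⟩
  2 ^ suc k + 2 ^ suc k
    ≡⟨ cong (2 ^ suc k +_) (+-identityʳ _) ⟨
  2 ^ suc (suc k) ∎
  where
  open ≡-Reasoning
  X = cliqueTuples pentagon (pentagon v) k
  pointwise : ∀ u → ⟦ pentagon v u ⟧ * cliqueTuples pentagon (pentagon v ∩ pentagon u) k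
    ≡ ⟦ pentagon v u ⟧ * (if does (u ≟ v) then X else 2 ^ k)
  pointwise u with u ≟ v
  ... | yes refl = cong (⟦ pentagon v v ⟧ *_) (cliqueTuples-cong pentagon k (λ w → ∧-idem (pentagon v w)))
  ... | no u≢v with pentagon v u in e
  ...   | false = refl
  ...   | true  = cong (1 *_) (pentagon-edge k v u u≢v e)

-- This is 2^k (2^(k+1) - 1) < 5^k without subtraction. It starts at k = 3, that is at 4-cliques,
-- with 128 < 133; for k = 2 it fails, 32 against 29.
4^k-bound : ∀ j → let k = 3 + j in 2 ^ k * 2 ^ suc k < 5 ^ k + 2 ^ k
4^k-bound zero    = ≤ᵇ⇒≤ _ _ tt
4^k-bound (suc j) = begin-strict
  2 * p * (2 * (2 * p))          ≡⟨ double p ⟩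
  4 * (p * (2 * p))              <⟨ *-monoʳ-< 4 (4^k-bound j) ⟩
  4 * (q + p)                    ≡⟨ split p q ⟩
  4 * q + 2 * p + 2 * p          ≤⟨ +-monoˡ-≤ (2 * p) (+-monoʳ-≤ (4 * q) 2p≤q) ⟩
  4 * q + q + 2 * p              ≡⟨ collect p q ⟩
  5 * q + 2 * p                  ∎
  where
  open ≤-Reasoning
  p = 2 ^ (3 + j)
  q = 5 ^ (3 + j)
  double : ∀ p → 2 * p * (2 * (2 * p)) ≡ 4 * (p * (2 * p))
  double = solve-∀
  split : ∀ p q → 4 * (q + p) ≡ 4 * q + 2 * p + 2 * p
  split = solve-∀
  collect : ∀ p q → 4 * q + q + 2 * p ≡ 5 * q + 2 * p
  collect = solve-∀
  2p≤q : 2 * p ≤ q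
  2p≤q = begin
    2 * (2 * (2 * (2 * 2 ^ j)))   ≡⟨ sixteen (2 ^ j) ⟩
    16 * 2 ^ j                    ≤⟨ *-mono-≤ (≤ᵇ⇒≤ 16 125 tt) (^-monoˡ-≤ j (≤ᵇ⇒≤ 2 5 tt)) ⟩
    125 * 5 ^ j                   ≡⟨ one-two-five (5 ^ j) ⟨
    5 * (5 * (5 * 5 ^ j))         ∎
    where
    sixteen : ∀ x → 2 * (2 * (2 * (2 * x))) ≡ 16 * x
    sixteen = solve-∀
    one-two-five : ∀ x → 5 * (5 * (5 * x)) ≡ 125 * x
    one-two-five = solve-∀

pentagon-few : ∀ j → let k = 3 + j in 2 ^ k * cliqueTuples pentagon full (suc k) < 5 ^ suc k
pentagon-few j = begin-strict
  2 ^ k * cliqueTuples pentagon full (suc k)  ≡⟨ cong (2 ^ k *_) (sum-cong-≗ each) ⟩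
  2 ^ k * sum {5} (λ _ → t)                   ≡⟨ cong (2 ^ k *_) (sum-const 5 t) ⟩
  2 ^ k * (5 * t)                             ≡⟨ arrange (2 ^ k) t ⟩
  5 * (2 ^ k * t)                             <⟨ *-monoʳ-< 5 (+-cancelʳ-< (2 ^ k) (2 ^ k * t) (5 ^ k) bound) ⟩
  5 * 5 ^ k                                   ∎
  where
  open ≤-Reasoning
  k = 3 + j
  t = cliqueTuples pentagon (pentagon zero) k
  each : ∀ v → 1 * cliqueTuples pentagon (pentagon v) k ≡ t
  each v = trans (*-identityˡ _)
    (suc-injective (trans (pentagon-neighbourhood k v) (sym (pentagon-neighbourhood k zero))))
  arrange : ∀ a t → a * (5 * t) ≡ 5 * (a * t)
  arrange = solve-∀
  bound : 2 ^ k * t + 2 ^ k < 5 ^ k + 2 ^ k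
  bound = begin-strict
    2 ^ k * t + 2 ^ k      ≡⟨ +-comm (2 ^ k * t) _ ⟩
    2 ^ k + 2 ^ k * t      ≡⟨ *-suc (2 ^ k) t ⟨
    2 ^ k * suc t          ≡⟨ cong (2 ^ k *_) (pentagon-neighbourhood k zero) ⟩
    2 ^ k * 2 ^ suc k      <⟨ 4^k-bound j ⟩
    5 ^ k + 2 ^ k          ∎

pentagon-pattern : ∀ j → Pattern 2 (3 + j)
pentagon-pattern j = record
  { size = 5 ; rel = pentagon ; symmetric = pentagon-sym
  ; independence = pentagon-independence ; few = pentagon-few j }

-- Adding loops to a graph

order : ∀ {n} → (Fin n → Bool) → ℕ
order P = sum (⟦_⟧ ∘ P)

sum-δ : ∀ {n} (u : Fin n) → sum (λ v → ⟦ does (u ≟ v) ⟧) ≡ 1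
sum-δ {suc n} zero = cong suc (sum-zero {n} (λ _ → refl))
sum-δ (suc u) = sum-δ u

reflexive : ∀ {n} → Rel₂ n → Rel₂ n
reflexive A u v = A u v ∨ does (u ≟ v)

-- A triple that is not a triangle has two equal entries.
cliqueTuples-reflexive : ∀ {n} (A : Rel₂ n) →
  cliqueTuples (reflexive A) full 3 ≤ cliqueTuples A full 3 + (3 * cliqueTuples A full 2 + n)
cliqueTuples-reflexive {n} A = begin
  sum (λ u → 1 * sum (λ v → ⟦ R u v ⟧ * common R u v))
    ≤⟨ sum-mono around ⟩
  sum (λ u → t u + (3 * (1 * d u) + 1))
    ≡⟨ ∑-distrib-+ t (λ u → 3 * (1 * d u) + 1) ⟩
  sum t + sum (λ u → 3 * (1 * d u) + 1)
    ≡⟨ cong (sum t +_) (∑-distrib-+ (λ u → 3 * (1 * d u)) (λ _ → 1)) ⟩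
  sum t + (sum (λ u → 3 * (1 * d u)) + sum {n} (λ _ → 1))
    ≡⟨ cong (sum t +_) (cong₂ _+_ (*-distribˡ-sum 3 (λ u → 1 * d u)) (trans (sym (*-identityʳ n)) (sym (sum-const n 1)))) ⟨
  sum t + (3 * sum (λ u → 1 * d u) + n)
    ∎
  where
  open ≤-Reasoning
  R = reflexive A
  δ : Rel₂ n
  δ u v = does (u ≟ v)
  common : Rel₂ n → Fin n → Fin n → ℕ
  common B u v = sum (λ w → ⟦ B u w ∧ B v w ⟧ * 1)
  d t : Fin n → ℕ
  d u = sum (λ v → ⟦ A u v ⟧ * 1)
  t u = 1 * sum (λ v → ⟦ A u v ⟧ * common A u v)
  either : ∀ a b x y → ⟦ (a ∨ x) ∧ (b ∨ y) ⟧ * 1 ≤ ⟦ a ∧ b ⟧ * 1 + (⟦ x ⟧ + ⟦ y ⟧)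
  either true  true  x     y     = s≤s z≤n
  either true  false x     true  = m≤n+m 1 ⟦ x ⟧
  either true  false x     false = z≤n
  either false b     true  y     = ≤-trans (⟦⟧*≤ (b ∨ y) 1) (s≤s z≤n)
  either false b     false y     = z≤n
  first : ∀ a b x y → ⟦ (a ∨ x) ∧ (b ∨ y) ⟧ * 1 ≤ ⟦ a ⟧ * 1 + ⟦ x ⟧
  first true  b x     y = ≤-trans (⟦⟧*≤ (b ∨ y) 1) (s≤s z≤n)
  first false b true  y = ⟦⟧*≤ (b ∨ y) 1
  first false b false y = z≤n
  common-edge : ∀ u v → common R u v ≤ common A u v + 2
  common-edge u v = begin
    common R u v
      ≤⟨ sum-mono (λ w → either (A u w) (A v w) (δ u w) (δ v w)) ⟩
    sum (λ w → ⟦ A u w ∧ A v w ⟧ * 1 + (⟦ δ u w ⟧ + ⟦ δ v w ⟧))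
      ≡⟨ ∑-distrib-+ (λ w → ⟦ A u w ∧ A v w ⟧ * 1) (λ w → ⟦ δ u w ⟧ + ⟦ δ v w ⟧) ⟩
    common A u v + sum (λ w → ⟦ δ u w ⟧ + ⟦ δ v w ⟧)
      ≡⟨ cong (common A u v +_) (trans (∑-distrib-+ (λ w → ⟦ δ u w ⟧) (λ w → ⟦ δ v w ⟧)) (cong₂ _+_ (sum-δ u) (sum-δ v))) ⟩
    common A u v + 2 ∎
  common-loop : ∀ u v → common R u v ≤ d u + 1
  common-loop u v = begin
    common R u v
      ≤⟨ sum-mono (λ w → first (A u w) (A v w) (δ u w) (δ v w)) ⟩
    sum (λ w → ⟦ A u w ⟧ * 1 + ⟦ δ u w ⟧)
      ≡⟨ ∑-distrib-+ (λ w → ⟦ A u w ⟧ * 1) (λ w → ⟦ δ u w ⟧) ⟩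
    d u + sum (λ w → ⟦ δ u w ⟧)
      ≡⟨ cong (d u +_) (sum-δ u) ⟩
    d u + 1 ∎
  -- If uv is an edge, the third entry is a common neighbour or one of u, v; if u = v, it is u or a
  -- neighbour of u. Summed over v the extra terms are 2 d + (d + 1) = 3 d + 1.
  pair : ∀ u v → ⟦ R u v ⟧ * common R u v ≤ ⟦ A u v ⟧ * common A u v + (2 * (⟦ A u v ⟧ * 1) + ⟦ δ u v ⟧ * (d u + 1))
  pair u v with A u v | δ u v
  ... | true  | x     = begin
    1 * common R u v                               ≡⟨ *-identityˡ _ ⟩
    common R u v                                   ≤⟨ common-edge u v ⟩
    common A u v + 2                               ≤⟨ +-mono-≤ (≤-reflexive (sym (*-identityˡ _))) (m≤m+n 2 _) ⟩
    1 * common A u v + (2 + ⟦ x ⟧ * (d u + 1))     ∎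
  ... | false | true  = *-monoʳ-≤ 1 (common-loop u v)
  ... | false | false = z≤n
  around : ∀ u → 1 * sum (λ v → ⟦ R u v ⟧ * common R u v) ≤ t u + (3 * (1 * d u) + 1)
  around u = begin
    1 * sum (λ v → ⟦ R u v ⟧ * common R u v)      ≡⟨ *-identityˡ _ ⟩
    sum (λ v → ⟦ R u v ⟧ * common R u v)          ≤⟨ sum-mono (pair u) ⟩
    sum (λ v → f v + (g v + h v))                 ≡⟨ ∑-distrib-+ f (λ v → g v + h v) ⟩
    sum f + sum (λ v → g v + h v)                 ≡⟨ cong (sum f +_) (∑-distrib-+ g h) ⟩
    sum f + (sum g + sum h)                       ≡⟨ cong (sum f +_) (cong₂ _+_ (*-distribˡ-sum 2 (λ v → ⟦ A u v ⟧ * 1)) (*-distribʳ-sum (d u + 1) (λ v → ⟦ δ u v ⟧))) ⟨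
    sum f + (2 * d u + sum (λ v → ⟦ δ u v ⟧) * (d u + 1))  ≡⟨ cong (λ x → sum f + (2 * d u + x * (d u + 1))) (sum-δ u) ⟩
    sum f + (2 * d u + 1 * (d u + 1))             ≡⟨ arrange (sum f) (d u) ⟩
    1 * sum f + (3 * (1 * d u) + 1)               ∎
    where
    f g h : Fin n → ℕ
    f v = ⟦ A u v ⟧ * common A u v
    g v = 2 * (⟦ A u v ⟧ * 1)
    h v = ⟦ δ u v ⟧ * (d u + 1)
    arrange : ∀ a d → a + (2 * d + 1 * (d + 1)) ≡ 1 * a + (3 * (1 * d) + 1)
    arrange = solve-∀

-- Meant for the complement of the random graph: a long independent list would be a clique there,
-- which is impossible once the clique count is zero.
cliqueTuples-positive : ∀ {n} (A : Rel₂ n) k P xs → k ≤ length xs → All (λ x → P x ≡ true) xs →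
  AllPairs (λ x y → A x y ≡ true) xs → 1 ≤ cliqueTuples A P k
cliqueTuples-positive A zero    P xs       _         _        _        = ≤-refl
cliqueTuples-positive A (suc k) P (x ∷ xs) (s≤s k≤) (px ∷ ps) (ax ∷ as) = begin
  1                                                 ≤⟨ cliqueTuples-positive A k (P ∩ A x) xs k≤
                                                         (All.zipWith (λ (p , a) → ∧-intro p a) (ps , ax)) as ⟩
  cliqueTuples A (P ∩ A x) k                        ≡⟨ *-identityˡ _ ⟨
  1 * cliqueTuples A (P ∩ A x) k                    ≡⟨ cong (λ b → ⟦ b ⟧ * cliqueTuples A (P ∩ A x) k) px ⟨
  ⟦ P x ⟧ * cliqueTuples A (P ∩ A x) k              ≤⟨ term≤sum (λ v → ⟦ P v ⟧ * cliqueTuples A (P ∩ A v) k) x ⟩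
  cliqueTuples A P (suc k)                          ∎
  where open ≤-Reasoning

-- Random graphs

-- The number of pairs among k vertices, with the pairs at one vertex split off as in `Edges`.
tri : ℕ → ℕ
tri zero    = 0
tri (suc k) = k + tri k

Edges : ℕ → Set
Edges zero    = ⊤
Edges (suc n) = Vec Bool n × Edges n

-- With `id` this is the graph itself and with `not` its loopless complement, so one expectation
-- formula serves both cliques and independent sets.
toRel : ∀ {n} → (Bool → Bool) → Edges n → Rel₂ n
toRel {suc n} f (row , g) zero    zero    = false
toRel {suc n} f (row , g) zero    (suc j) = f (lookup row j)
toRel {suc n} f (row , g) (suc i) zero    = f (lookup row i)
toRel {suc n} f (row , g) (suc i) (suc j) = toRel f g i j

toRel-sym : ∀ {n} f (g : Edges n) → Symmetric₂ (toRel f g)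
toRel-sym {suc n} f (row , g) zero    zero    = refl
toRel-sym {suc n} f (row , g) zero    (suc j) = refl
toRel-sym {suc n} f (row , g) (suc i) zero    = refl
toRel-sym {suc n} f (row , g) (suc i) (suc j) = toRel-sym f g i j

toRel-irrefl : ∀ {n} f (g : Edges n) i → toRel f g i i ≡ false
toRel-irrefl {suc n} f (row , g) zero    = refl
toRel-irrefl {suc n} f (row , g) (suc i) = toRel-irrefl f g i

toRel-not : ∀ {n} (g : Edges n) i j → reflexive (toRel id g) i j ≡ false → toRel not g i j ≡ true
toRel-not {suc n} (row , g) zero    (suc j) e with lookup row j | e
... | false | _ = refl
toRel-not {suc n} (row , g) (suc i) zero    e with lookup row i | e
... | false | _ = refl
toRel-not {suc n} (row , g) (suc i) (suc j) e = toRel-not g i j e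

-- ΣRow and ΣEdges are q^n and q^(tri n) times the expectation over independent edges, each present
-- with probability w₁ / q.
module Weighted (w₁ w₀ q : ℕ) (w₁+w₀≡q : w₁ + w₀ ≡ q) where

  ΣRow : ∀ n → (Vec Bool n → ℕ) → ℕ
  ΣRow zero    F = F []
  ΣRow (suc n) F = w₁ * ΣRow n (F ∘ (true ∷_)) + w₀ * ΣRow n (F ∘ (false ∷_))

  ΣEdges : ∀ n → (Edges n → ℕ) → ℕ
  ΣEdges zero    F = F tt
  ΣEdges (suc n) F = ΣRow n (λ row → ΣEdges n (λ g → F (row , g)))

  ΣRow-cong : ∀ n {F G : Vec Bool n → ℕ} → F ≗ G → ΣRow n F ≡ ΣRow n G
  ΣRow-cong zero    F≗G = F≗G []
  ΣRow-cong (suc n) F≗G = cong₂ (λ x y → w₁ * x + w₀ * y) (ΣRow-cong n (λ r → F≗G (true ∷ r))) (ΣRow-cong n (λ r → F≗G (false ∷ r)))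

  ΣRow-+ : ∀ n (F G : Vec Bool n → ℕ) → ΣRow n (λ r → F r + G r) ≡ ΣRow n F + ΣRow n G
  ΣRow-+ zero    F G = refl
  ΣRow-+ (suc n) F G = trans
    (cong₂ (λ x y → w₁ * x + w₀ * y) (ΣRow-+ n (F ∘ (true ∷_)) (G ∘ (true ∷_))) (ΣRow-+ n (F ∘ (false ∷_)) (G ∘ (false ∷_))))
    (arrange w₁ w₀ _ _ _ _)
    where
    arrange : ∀ a b c d e f → a * (c + d) + b * (e + f) ≡ (a * c + b * e) + (a * d + b * f)
    arrange = solve-∀

  ΣRow-* : ∀ n c (F : Vec Bool n → ℕ) → ΣRow n (λ r → c * F r) ≡ c * ΣRow n F
  ΣRow-* zero    c F = refl
  ΣRow-* (suc n) c F = trans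
    (cong₂ (λ x y → w₁ * x + w₀ * y) (ΣRow-* n c (F ∘ (true ∷_))) (ΣRow-* n c (F ∘ (false ∷_))))
    (arrange w₁ w₀ c _ _)
    where
    arrange : ∀ a b c d e → a * (c * d) + b * (c * e) ≡ c * (a * d + b * e)
    arrange = solve-∀

  ΣRow-const : ∀ n c → ΣRow n (λ _ → c) ≡ c * q ^ n
  ΣRow-const zero    c = sym (*-identityʳ c)
  ΣRow-const (suc n) c = trans (cong (λ x → w₁ * x + w₀ * x) (ΣRow-const n c))
    (trans (arrange w₁ w₀ c (q ^ n)) (cong (λ x → c * (x * q ^ n)) w₁+w₀≡q))
    where
    arrange : ∀ a b c d → a * (c * d) + b * (c * d) ≡ c * ((a + b) * d)
    arrange = solve-∀

  ΣEdges-+ : ∀ n (F G : Edges n → ℕ) → ΣEdges n (λ g → F g + G g) ≡ ΣEdges n F + ΣEdges n G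
  ΣEdges-+ zero    F G = refl
  ΣEdges-+ (suc n) F G = trans (ΣRow-cong n (λ r → ΣEdges-+ n (λ g → F (r , g)) (λ g → G (r , g)))) (ΣRow-+ n _ _)

  ΣEdges-* : ∀ n c (F : Edges n → ℕ) → ΣEdges n (λ g → c * F g) ≡ c * ΣEdges n F
  ΣEdges-* zero    c F = refl
  ΣEdges-* (suc n) c F = trans (ΣRow-cong n (λ r → ΣEdges-* n c (λ g → F (r , g)))) (ΣRow-* n c _)

  ΣEdges-const : ∀ n c → ΣEdges n (λ _ → c) ≡ c * q ^ tri n
  ΣEdges-const zero    c = sym (*-identityʳ c)
  ΣEdges-const (suc n) c = begin
    ΣRow n (λ _ → ΣEdges n (λ _ → c))   ≡⟨ ΣRow-const n _ ⟩
    ΣEdges n (λ _ → c) * q ^ n          ≡⟨ cong (_* q ^ n) (ΣEdges-const n c) ⟩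
    c * q ^ tri n * q ^ n               ≡⟨ *-assoc c _ _ ⟩
    c * (q ^ tri n * q ^ n)             ≡⟨ cong (c *_) (*-comm (q ^ tri n) _) ⟩
    c * (q ^ n * q ^ tri n)             ≡⟨ cong (c *_) (^-distribˡ-+-* q n (tri n)) ⟨
    c * q ^ (n + tri n)                 ∎
    where open ≡-Reasoning

  -- The method of conditional expectations: if the mean is below `c`, one of the two values of the
  -- next bit keeps the conditional mean below `c`, and deciding which one makes the choice
  -- constructive.
  ΣRow-witness : ∀ n c (F : Vec Bool n → ℕ) → ΣRow n F < c * q ^ n → ∃ λ r → F r < c
  ΣRow-witness zero    c F small = [] , subst (F [] <_) (*-identityʳ c) small
  ΣRow-witness (suc n) c F small with ΣRow n (F ∘ (true ∷_)) <? c * q ^ n | ΣRow n (F ∘ (false ∷_)) <? c * q ^ n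
  ... | yes lt | _      = let r , Fr<c = ΣRow-witness n c _ lt in true ∷ r , Fr<c
  ... | no _   | yes lt = let r , Fr<c = ΣRow-witness n c _ lt in false ∷ r , Fr<c
  ... | no ge₁ | no ge₀ = ⊥-elim (<⇒≱ small (begin
    c * (q * q ^ n)                             ≡⟨ cong (λ x → c * (x * q ^ n)) w₁+w₀≡q ⟨
    c * ((w₁ + w₀) * q ^ n)                     ≡⟨ arrange w₁ w₀ c (q ^ n) ⟩
    w₁ * (c * q ^ n) + w₀ * (c * q ^ n)         ≤⟨ +-mono-≤ (*-monoʳ-≤ w₁ (≮⇒≥ ge₁)) (*-monoʳ-≤ w₀ (≮⇒≥ ge₀)) ⟩
    ΣRow (suc n) F                              ∎))
    where
    open ≤-Reasoning
    arrange : ∀ a b c d → c * ((a + b) * d) ≡ a * (c * d) + b * (c * d)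
    arrange = solve-∀

  ΣEdges-witness : ∀ n c (F : Edges n → ℕ) → ΣEdges n F < c * q ^ tri n → ∃ λ g → F g < c
  ΣEdges-witness zero    c F small = tt , subst (F tt <_) (*-identityʳ c) small
  ΣEdges-witness (suc n) c F small with ΣRow-witness n (c * q ^ tri n) _ (subst (ΣEdges (suc n) F <_) split small)
    where
    arrange : ∀ a b c → a * (b * c) ≡ a * c * b
    arrange = solve-∀
    split : c * q ^ (n + tri n) ≡ c * q ^ tri n * q ^ n
    split = trans (cong (c *_) (^-distribˡ-+-* q n (tri n))) (arrange c (q ^ n) _)
  ... | r , small′ with ΣEdges-witness n c (λ g → F (r , g)) small′
  ... | g , Fg<c = (r , g) , Fg<c

  module _ (f : Bool → Bool) (w w′ : ℕ) (w+w′≡q : w + w′ ≡ q)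
    (reweigh : ∀ (X : Bool → ℕ) → w₁ * X (f true) + w₀ * X (f false) ≡ w * X true + w′ * X false) where

    -- Here w / q is the probability that `f` turns a random bit into `true`. Each k-subset of `P`
    -- lies in the random neighbourhood with probability (w / q)^k; the induction over the vertices
    -- is Pascal's rule.
    ΣRow-C : ∀ n (P : Fin n → Bool) k →
      ΣRow n (λ r → order (P ∩ (f ∘ lookup r)) C k) * q ^ k ≡ (order P C k) * w ^ k * q ^ n
    ΣRow-C n       P zero    = trans (*-identityʳ _) (ΣRow-const n 1)
    ΣRow-C zero    P (suc k) = refl
    ΣRow-C (suc n) P (suc k) = trans
      (cong (_* q ^ suc k) (reweigh (λ b → ΣRow n (λ r → (⟦ P zero ∧ b ⟧ + order (P′ ∩ (f ∘ lookup r))) C suc k))))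
      (by-head (P zero))
      where
      open ≡-Reasoning
      P′ = P ∘ suc
      s : Vec Bool n → ℕ
      s r = order (P′ ∩ (f ∘ lookup r))
      x y : ℕ
      x = ΣRow n (λ r → s r C k)
      y = ΣRow n (λ r → s r C suc k)
      by-head : ∀ b → (w * ΣRow n (λ r → (⟦ b ∧ true ⟧ + s r) C suc k) + w′ * ΣRow n (λ r → (⟦ b ∧ false ⟧ + s r) C suc k)) * q ^ suc k
        ≡ ((⟦ b ⟧ + order P′) C suc k) * w ^ suc k * q ^ suc n
      by-head false = begin
        (w * y + w′ * y) * q ^ suc k                       ≡⟨ gather w w′ y (q ^ suc k) ⟩
        (w + w′) * (y * q ^ suc k)                         ≡⟨ cong₂ _*_ w+w′≡q (ΣRow-C n P′ (suc k)) ⟩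
        q * ((order P′ C suc k) * w ^ suc k * q ^ n)       ≡⟨ spread q ((order P′ C suc k) * w ^ suc k) (q ^ n) ⟩
        (order P′ C suc k) * w ^ suc k * (q * q ^ n)       ∎
        where
        gather : ∀ a b c d → (a * c + b * c) * d ≡ (a + b) * (c * d)
        gather = solve-∀
        spread : ∀ a b c → a * (b * c) ≡ b * (a * c)
        spread = solve-∀
      by-head true = begin
        (w * ΣRow n (λ r → suc (s r) C suc k) + w′ * y) * q ^ suc k
          ≡⟨ cong (λ z → (w * z + w′ * y) * q ^ suc k)
               (trans (ΣRow-cong n (λ r → sym (nCk+nC[k+1]≡[n+1]C[k+1] (s r) k))) (ΣRow-+ n _ _)) ⟩
        (w * (x + y) + w′ * y) * q ^ suc k
          ≡⟨ gather w w′ x y q (q ^ k) ⟩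
        w * q * (x * q ^ k) + (w + w′) * (y * q ^ suc k)
          ≡⟨ cong₂ _+_ (cong (w * q *_) (ΣRow-C n P′ k)) (cong₂ _*_ w+w′≡q (ΣRow-C n P′ (suc k))) ⟩
        w * q * ((order P′ C k) * w ^ k * q ^ n) + q * ((order P′ C suc k) * (w * w ^ k) * q ^ n)
          ≡⟨ spread w q (order P′ C k) (order P′ C suc k) (w ^ k) (q ^ n) ⟩
        ((order P′ C k) + (order P′ C suc k)) * (w * w ^ k) * (q * q ^ n)
          ≡⟨ cong (λ z → z * (w * w ^ k) * (q * q ^ n)) (nCk+nC[k+1]≡[n+1]C[k+1] (order P′) k) ⟩
        (suc (order P′) C suc k) * w ^ suc k * q ^ suc n ∎
        where
        gather : ∀ w w′ x y q p → (w * (x + y) + w′ * y) * (q * p) ≡ w * q * (x * p) + (w + w′) * (y * (q * p))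
        gather = solve-∀
        spread : ∀ w q a b u v → w * q * (a * u * v) + q * (b * (w * u) * v) ≡ (a + b) * (w * u) * (q * v)
        spread = solve-∀

    -- The mean number of k-cliques inside `P`, each k-subset contributing (w / q) to the number of
    -- its pairs. Cliques through `zero` are cliques in its neighbourhood, whose row is independent
    -- of the remaining graph, so `ΣRow-C` averages the inductive count.
    ΣEdges-cliques : ∀ n (P : Fin n → Bool) k →
      ΣEdges n (λ g → cliques (toRel f g) P k) * q ^ tri k ≡ (order P C k) * w ^ tri k * q ^ tri n
    ΣEdges-cliques n       P zero    = trans (*-identityʳ _) (ΣEdges-const n 1)
    ΣEdges-cliques zero    P (suc k) = refl
    ΣEdges-cliques (suc n) P (suc k) = begin
      ΣRow n (λ r → ΣEdges n (λ g → p * cliques (toRel f g) (nbrs r) k + cliques (toRel f g) P′ (suc k))) * q ^ tri (suc k)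
        ≡⟨ cong (_* q ^ tri (suc k)) linear ⟩
      (p * ΣRow n e₁ + e₂ * q ^ n) * q ^ tri (suc k)
        ≡⟨ *-distribʳ-+ (q ^ tri (suc k)) (p * ΣRow n e₁) _ ⟩
      p * ΣRow n e₁ * q ^ tri (suc k) + e₂ * q ^ n * q ^ tri (suc k)
        ≡⟨ cong₂ _+_ through-zero avoiding-zero ⟩
      p * a * w ^ tri (suc k) * q ^ tri (suc n) + b * w ^ tri (suc k) * q ^ tri (suc n)
        ≡⟨ gather (p * a) b (w ^ tri (suc k)) (q ^ tri (suc n)) ⟩
      (p * a + b) * w ^ tri (suc k) * q ^ tri (suc n)
        ≡⟨ cong (λ z → z * w ^ tri (suc k) * q ^ tri (suc n)) (pascal (P zero)) ⟩
      (order P C suc k) * w ^ tri (suc k) * q ^ tri (suc n) ∎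
      where
      open ≡-Reasoning
      P′ = P ∘ suc
      p = ⟦ P zero ⟧
      a = order P′ C k
      b = order P′ C suc k
      nbrs : Vec Bool n → Fin n → Bool
      nbrs r = P′ ∩ (f ∘ lookup r)
      e₁ : Vec Bool n → ℕ
      e₁ r = ΣEdges n (λ g → cliques (toRel f g) (nbrs r) k)
      e₂ : ℕ
      e₂ = ΣEdges n (λ g → cliques (toRel f g) P′ (suc k))
      gather : ∀ a b c d → a * c * d + b * c * d ≡ (a + b) * c * d
      gather = solve-∀
      pascal : ∀ c → ⟦ c ⟧ * a + b ≡ (⟦ c ⟧ + order P′) C suc k
      pascal true  = trans (cong (_+ b) (*-identityˡ a)) (nCk+nC[k+1]≡[n+1]C[k+1] (order P′) k)
      pascal false = refl
      linear : ΣEdges (suc n) (λ g → cliques (toRel f g) P (suc k)) ≡ p * ΣRow n e₁ + e₂ * q ^ n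
      linear = begin
        ΣRow n (λ r → ΣEdges n (λ g → p * cliques (toRel f g) (nbrs r) k + cliques (toRel f g) P′ (suc k)))
          ≡⟨ ΣRow-cong n (λ r → trans (ΣEdges-+ n _ _) (cong (_+ e₂) (ΣEdges-* n p _))) ⟩
        ΣRow n (λ r → p * e₁ r + e₂)
          ≡⟨ ΣRow-+ n _ _ ⟩
        ΣRow n (λ r → p * e₁ r) + ΣRow n (λ _ → e₂)
          ≡⟨ cong₂ _+_ (ΣRow-* n p e₁) (ΣRow-const n e₂) ⟩
        p * ΣRow n e₁ + e₂ * q ^ n ∎
      wₖ = w ^ tri k
      qₙ = q ^ tri n
      rows : ΣRow n e₁ * q ^ tri k ≡ wₖ * qₙ * ΣRow n (λ r → order (nbrs r) C k)
      rows = begin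
        ΣRow n e₁ * q ^ tri k               ≡⟨ *-comm (ΣRow n e₁) _ ⟩
        q ^ tri k * ΣRow n e₁               ≡⟨ ΣRow-* n (q ^ tri k) e₁ ⟨
        ΣRow n (λ r → q ^ tri k * e₁ r)     ≡⟨ ΣRow-cong n (λ r → trans (*-comm (q ^ tri k) (e₁ r))
                                                (trans (ΣEdges-cliques n (nbrs r) k) (rotate (order (nbrs r) C k) wₖ qₙ))) ⟩
        ΣRow n (λ r → wₖ * qₙ * (order (nbrs r) C k))  ≡⟨ ΣRow-* n (wₖ * qₙ) _ ⟩
        wₖ * qₙ * ΣRow n (λ r → order (nbrs r) C k)    ∎
        where
        rotate : ∀ a b c → a * b * c ≡ b * c * a
        rotate = solve-∀
      through-zero : p * ΣRow n e₁ * q ^ tri (suc k) ≡ p * a * w ^ tri (suc k) * q ^ tri (suc n)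
      through-zero = begin
        p * ΣRow n e₁ * q ^ (k + tri k)            ≡⟨ cong (p * ΣRow n e₁ *_) (^-distribˡ-+-* q k (tri k)) ⟩
        p * ΣRow n e₁ * (q ^ k * q ^ tri k)        ≡⟨ regroup₁ p (ΣRow n e₁) (q ^ k) (q ^ tri k) ⟩
        p * q ^ k * (ΣRow n e₁ * q ^ tri k)        ≡⟨ cong (p * q ^ k *_) rows ⟩
        p * q ^ k * (wₖ * qₙ * z)                  ≡⟨ regroup₂ p (q ^ k) (wₖ * qₙ) z ⟩
        p * (wₖ * qₙ) * (z * q ^ k)                ≡⟨ cong (p * (wₖ * qₙ) *_) (ΣRow-C n P′ k) ⟩
        p * (wₖ * qₙ) * (a * w ^ k * q ^ n)        ≡⟨ regroup₃ p wₖ qₙ a (w ^ k) (q ^ n) ⟩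
        p * a * (w ^ k * wₖ) * (q ^ n * qₙ)        ≡⟨ cong₂ (λ x y → p * a * x * y) (^-distribˡ-+-* w k (tri k)) (^-distribˡ-+-* q n (tri n)) ⟨
        p * a * w ^ (k + tri k) * q ^ (n + tri n)  ∎
        where
        z = ΣRow n (λ r → order (nbrs r) C k)
        regroup₁ : ∀ a b c d → a * b * (c * d) ≡ a * c * (b * d)
        regroup₁ = solve-∀
        regroup₂ : ∀ a b c d → a * b * (c * d) ≡ a * c * (d * b)
        regroup₂ = solve-∀
        regroup₃ : ∀ p x y a u v → p * (x * y) * (a * u * v) ≡ p * a * (u * x) * (v * y)
        regroup₃ = solve-∀
      avoiding-zero : e₂ * q ^ n * q ^ tri (suc k) ≡ b * w ^ tri (suc k) * q ^ tri (suc n)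
      avoiding-zero = begin
        e₂ * q ^ n * q ^ tri (suc k)               ≡⟨ regroup₁ e₂ (q ^ n) _ ⟩
        q ^ n * (e₂ * q ^ tri (suc k))             ≡⟨ cong (q ^ n *_) (ΣEdges-cliques n P′ (suc k)) ⟩
        q ^ n * (b * w ^ tri (suc k) * qₙ)         ≡⟨ regroup₂ (q ^ n) (b * w ^ tri (suc k)) qₙ ⟩
        b * w ^ tri (suc k) * (q ^ n * qₙ)         ≡⟨ cong (b * w ^ tri (suc k) *_) (^-distribˡ-+-* q n (tri n)) ⟨
        b * w ^ tri (suc k) * q ^ (n + tri n)      ∎
        where
        regroup₁ : ∀ a b c → a * b * c ≡ b * (a * c)
        regroup₁ = solve-∀
        regroup₂ : ∀ a b c → a * (b * c) ≡ b * (a * c)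
        regroup₂ = solve-∀

-- The first-moment argument and its numerical instance

-- Rounding (w / q)^s up to u / v splits the check into an s-th and a t-th power. In the application
-- the undivided power q^(s t) would have millions of digits.
power-bound : ∀ {w v u q c D} s t .{{_ : NonZero v}} →
  w ^ s * v ≤ u * q ^ s → D * (c * u ^ t) ≤ v ^ t → D * (c * w ^ (s * t)) ≤ q ^ (s * t)
power-bound {w} {v} {u} {q} {c} {D} s t base total = *-cancelʳ-≤ _ _ (v ^ t) {{m^n≢0 v t}} (begin
  D * (c * w ^ (s * t)) * v ^ t            ≡⟨ cong (λ x → D * (c * x) * v ^ t) (^-*-assoc w s t) ⟨
  D * (c * (w ^ s) ^ t) * v ^ t            ≡⟨ regroup₁ D c ((w ^ s) ^ t) (v ^ t) ⟩
  D * c * ((w ^ s) ^ t * v ^ t)            ≡⟨ cong (D * c *_) (^-distrib-* (w ^ s) v t) ⟨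
  D * c * (w ^ s * v) ^ t                  ≤⟨ *-monoʳ-≤ (D * c) (^-monoˡ-≤ t base) ⟩
  D * c * (u * q ^ s) ^ t                  ≡⟨ cong (D * c *_) (^-distrib-* u (q ^ s) t) ⟩
  D * c * (u ^ t * (q ^ s) ^ t)            ≡⟨ regroup₂ D c (u ^ t) ((q ^ s) ^ t) ⟩
  (q ^ s) ^ t * (D * (c * u ^ t))          ≤⟨ *-monoʳ-≤ ((q ^ s) ^ t) total ⟩
  (q ^ s) ^ t * v ^ t                      ≡⟨ cong (_* v ^ t) (^-*-assoc q s t) ⟩
  q ^ (s * t) * v ^ t                      ∎)
  where
  open ≤-Reasoning
  regroup₁ : ∀ a b c d → a * (b * c) * d ≡ a * b * (c * d)
  regroup₁ = solve-∀
  regroup₂ : ∀ a b c d → a * b * (c * d) ≡ d * (a * (b * c))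
  regroup₂ = solve-∀

factor≡0 : ∀ a b {c} → a * b + c < a → b ≡ 0
factor≡0 a zero    _  = refl
factor≡0 a (suc b) lt = ⊥-elim (<⇒≱ lt (≤-trans (m≤m*n a (suc b)) (m≤m+n _ _)))

module _ (m r w₀ q W D : ℕ) (1+w₀≡q : 1 + w₀ ≡ q)
  .{{_ : NonZero q}} .{{_ : NonZero D}} .{{_ : NonZero r}}
  -- The mean number of independent sets of size r + 1 is at most 1 / D. Divided by `D * W * q ^ 3`,
  -- `few-triples` reads 1 / D + 6 (E e + E t) / W < 1, with E e and E t the mean numbers of edges
  -- and triangles.
  (few-independent : D * ((m C suc r) * w₀ ^ tri (suc r)) ≤ q ^ tri (suc r))
  (few-triples : W * q ^ 3 + 6 * D * (q ^ 2 * (m C 2) + (m C 3)) < D * W * q ^ 3)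
  (budget : r ^ 2 * (m + W) ≤ m ^ 3) where

  open Weighted 1 w₀ q 1+w₀≡q

  private
    l = suc r

    -- A cost below W rules out independent l-sets and leaves few edges and triangles.
    independents edges triangles cost : Edges m → ℕ
    independents g = cliques (toRel not g) full l
    edges        g = cliques (toRel id g) full 2
    triangles    g = cliques (toRel id g) full 3
    cost         g = W * independents g + 6 * (edges g + triangles g)

    order-full : order {m} full ≡ m
    order-full = trans (sum-const m 1) (*-identityʳ m)

    total = q ^ tri m

    Σ-independents : ΣEdges m independents * q ^ tri l ≡ (m C l) * w₀ ^ tri l * total
    Σ-independents = trans
      (ΣEdges-cliques not w₀ 1 (trans (+-comm w₀ 1) 1+w₀≡q) (λ X → +-comm (1 * X false) _) m full l)
      (cong (λ x → (x C l) * w₀ ^ tri l * total) order-full)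

    Σ-cliques : ∀ k → ΣEdges m (λ g → cliques (toRel id g) full k) * q ^ tri k ≡ (m C k) * total
    Σ-cliques k = trans (ΣEdges-cliques id 1 w₀ 1+w₀≡q (λ X → refl) m full k) (trans
      (cong₂ (λ x y → x * y * total) (cong (_C k) order-full) (^-zeroˡ (tri k)))
      (cong (_* total) (*-identityʳ (m C k))))

    D*Σ-independents : D * ΣEdges m independents ≤ total
    D*Σ-independents = *-cancelʳ-≤ _ _ (q ^ tri l) {{m^n≢0 q (tri l)}} (begin
      D * ΣEdges m independents * q ^ tri l             ≡⟨ *-assoc D _ _ ⟩
      D * (ΣEdges m independents * q ^ tri l)           ≡⟨ cong (D *_) Σ-independents ⟩
      D * ((m C l) * w₀ ^ tri l * total)                ≡⟨ *-assoc D _ total ⟨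
      D * ((m C l) * w₀ ^ tri l) * total                ≤⟨ *-monoˡ-≤ total few-independent ⟩
      q ^ tri l * total                                 ≡⟨ *-comm (q ^ tri l) total ⟩
      total * q ^ tri l                                 ∎)
      where open ≤-Reasoning

    cost-small : ΣEdges m cost < W * total
    -- The factor `D * q ^ 3` clears 1 / D and the probabilities 1 / q of an edge and 1 / q³ of a
    -- triangle at once.
    cost-small = *-cancelʳ-< (D * q ^ 3) _ _ (begin-strict
      ΣEdges m cost * (D * q ^ 3)
        ≡⟨ cong (_* (D * q ^ 3)) linear ⟩
      (W * I + 6 * (E + T₃)) * (D * q ^ 3)
        ≡⟨ expand W I E T₃ D q ⟩
      W * q ^ 3 * (D * I) + 6 * D * (q ^ 2 * (E * q ^ 1) + T₃ * q ^ 3)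
        ≡⟨ cong (λ x → W * q ^ 3 * (D * I) + 6 * D * x) (cong₂ (λ x y → q ^ 2 * x + y) (Σ-cliques 2) (Σ-cliques 3)) ⟩
      W * q ^ 3 * (D * I) + 6 * D * (q ^ 2 * ((m C 2) * total) + (m C 3) * total)
        ≤⟨ +-monoˡ-≤ _ (*-monoʳ-≤ (W * q ^ 3) D*Σ-independents) ⟩
      W * q ^ 3 * total + 6 * D * (q ^ 2 * ((m C 2) * total) + (m C 3) * total)
        ≡⟨ collect (W * q ^ 3) (6 * D) (q ^ 2) (m C 2) (m C 3) total ⟩
      (W * q ^ 3 + 6 * D * (q ^ 2 * (m C 2) + (m C 3))) * total
        <⟨ *-monoˡ-< total {{m^n≢0 q (tri m)}} few-triples ⟩
      D * W * q ^ 3 * total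
        ≡⟨ regroup D W (q ^ 3) total ⟩
      W * total * (D * q ^ 3) ∎)
      where
      open ≤-Reasoning
      I  = ΣEdges m independents
      E  = ΣEdges m edges
      T₃ = ΣEdges m triangles
      linear : ΣEdges m cost ≡ W * I + 6 * (E + T₃)
      linear = trans (ΣEdges-+ m _ _) (cong₂ _+_ (ΣEdges-* m W independents)
        (trans (ΣEdges-* m 6 _) (cong (6 *_) (ΣEdges-+ m edges triangles))))
      expand : ∀ W I E T D q → (W * I + 6 * (E + T)) * (D * (q * (q * (q * 1))))
        ≡ W * (q * (q * (q * 1))) * (D * I) + 6 * D * ((q * (q * 1)) * (E * (q * 1)) + T * (q * (q * (q * 1))))
      expand = solve-∀
      collect : ∀ a b c x y t → a * t + b * (c * (x * t) + y * t) ≡ (a + b * (c * x + y)) * t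
      collect = solve-∀
      regroup : ∀ a b c d → a * b * c * d ≡ b * d * (a * c)
      regroup = solve-∀

  pattern-of : ∀ g → cost g < W → Pattern r 2
  pattern-of g cost<W = record
    { size         = m
    ; rel          = reflexive A
    ; symmetric    = R-sym
    ; independence = α-R
    ; few          = few-R
    }
    where
    open ≤-Reasoning
    A = toRel id g
    R-sym : Symmetric₂ (reflexive A)
    R-sym u v = cong₂ _∨_ (toRel-sym id g u v) (≟-sym u v)
      where
      ≟-sym : ∀ (u v : Fin m) → does (u ≟ v) ≡ does (v ≟ u)
      ≟-sym u v = does-⇔ (mk⇔ sym sym) (u ≟ v) (v ≟ u)
    no-independent : independents g ≡ 0
    no-independent = factor≡0 W _ cost<W
    α-R : ∀ xs → Independent (reflexive A) xs → length xs ≤ r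
    α-R xs ind = ≮⇒≥ λ r<len → <⇒≱
      (cliqueTuples-positive (toRel not g) l full xs r<len (All.universal (λ _ → refl) xs)
        (AllPairs.map (λ {x} {y} → toRel-not g x y) ind))
      (≤-reflexive (trans (sym (!*cliques≡cliqueTuples (toRel not g) (toRel-sym not g) (toRel-irrefl not g) full l))
        (trans (cong (l ! *_) no-independent) (*-zeroʳ (l !)))))
    tuples : ∀ k → cliqueTuples A full k ≡ k ! * cliques A full k
    tuples k = sym (!*cliques≡cliqueTuples A (toRel-sym id g) (toRel-irrefl id g) full k)
    few-R : r ^ 2 * cliqueTuples (reflexive A) full 3 < m ^ 3
    few-R = begin-strict
      r ^ 2 * cliqueTuples (reflexive A) full 3
        ≤⟨ *-monoʳ-≤ (r ^ 2) (cliqueTuples-reflexive A) ⟩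
      r ^ 2 * (cliqueTuples A full 3 + (3 * cliqueTuples A full 2 + m))
        ≡⟨ cong (r ^ 2 *_) (trans (cong₂ (λ x y → x + (3 * y + m)) (tuples 3) (tuples 2)) (collect (triangles g) (edges g) m)) ⟩
      r ^ 2 * (m + 6 * (edges g + triangles g))
        <⟨ *-monoʳ-< (r ^ 2) {{m^n≢0 r 2}} (+-monoʳ-< m (≤-<-trans (m≤n+m _ (W * independents g)) cost<W)) ⟩
      r ^ 2 * (m + W)
        ≤⟨ budget ⟩
      m ^ 3 ∎
      where
      collect : ∀ t e m → 6 * t + (3 * (2 * e) + m) ≡ m + 6 * (e + t)
      collect = solve-∀

  random-pattern : Pattern r 2
  random-pattern = let g , cost<W = ΣEdges-witness m W cost cost-small in pattern-of g cost<W

-- Leaves only closed numerical conditions, which evaluation can decide for concrete parameters. For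
-- r = 2073 the exponent is 2073 · 2074 / 2 = 2073 · 1037.
random-pattern-of-powers : ∀ m r w₀ W D s t u v .{{_ : NonZero D}} .{{_ : NonZero r}} .{{_ : NonZero v}} →
  tri (suc r) ≡ s * t → w₀ ^ s * v ≤ u * suc w₀ ^ s → D * ((m C suc r) * u ^ t) ≤ v ^ t →
  W * suc w₀ ^ 3 + 6 * D * (suc w₀ ^ 2 * (m C 2) + (m C 3)) < D * W * suc w₀ ^ 3 →
  r ^ 2 * (m + W) ≤ m ^ 3 → Pattern r 2
random-pattern-of-powers m r w₀ W D s t u v tri≡ base total = random-pattern m r w₀ (suc w₀) W D refl
  (subst (λ e → D * ((m C suc r) * w₀ ^ e) ≤ suc w₀ ^ e) (sym tri≡) (power-bound {u = u} {c = m C suc r} {D = D} s t base total))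

-- Edge probability 1/194 on 162000 vertices: the expected number of independent 2074-sets is below
-- 1/10000, where (193/194)^2073 is rounded up to 2225/10^8, and 989179984 is ⌊162000³/2073²⌋ ∸ 162000.
pattern-2073 : Pattern 2073 2
pattern-2073 = random-pattern-of-powers 162000 2073 193 989179984 10000 2073 1037 2225 100000000
  refl (≤ᵇ⇒≤ _ _ tt) (≤ᵇ⇒≤ _ _ tt) (≤ᵇ⇒≤ _ _ tt) (≤ᵇ⇒≤ _ _ tt)

theorem2p1 : (k l : ℕ) → ((4 ≤ k × 3 ≤ l) ⊎ (k ≡ 3 × 2074 ≤ l)) →
    ∃ λ N → ∀ n → N ≤ n →
    Σ (Graph n) λ G → IndepNumberLessThan G l ×
    cliqueCount k G < cliqueCount k (turanComplement n (l ∸ 1))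
theorem2p1 (suc (suc (suc (suc j)))) (suc r) (inj₁ (_ , s≤s 2≤r)) =
  pattern-beats-turán r (3 + j) {{>-nonZero (≤-trans (s≤s z≤n) 2≤r)}} (pattern-mono 2≤r (pentagon-pattern j))
theorem2p1 (suc zero) _ (inj₁ (s≤s () , _))
theorem2p1 (suc (suc zero)) _ (inj₁ (s≤s (s≤s ()) , _))
theorem2p1 (suc (suc (suc zero))) _ (inj₁ (s≤s (s≤s (s≤s ())) , _))
theorem2p1 .3 (suc r) (inj₂ (refl , s≤s 2073≤r)) =
  pattern-beats-turán r 2 {{>-nonZero (≤-trans (s≤s z≤n) 2073≤r)}} (pattern-mono 2073≤r pattern-2073)
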